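{- Let $s$ be a weak composition. The $f$-polynomial $f_s(t)=\sum_{F\in\operatorname{Perm}(s)}t^{\dim(F)}$ of the $s$-permutahedron $\operatorname{Perm}(s)$ is given by $$\sum_{T}(1+t)^{\operatorname{asc}(T)},$$ where the sum runs over all $s$-decreasing trees $T$ and $\operatorname{asc}(T)$ denotes the number of tree-ascents of $T$.
   Context: A weak composition of length $n$ is a sequence $s=(s(1),\dots,s(n))$ of non-negative integers. An $s$-decreasing tree is a rooted planar tree with $n$ internal nodes labeled bijectively by $1,\dots,n$ (leaves are unlabeled) such that node $i$ has exactly $s(i)+1$ ordered children and labels decrease from root to leaves. For a node $y$ of such a tree $T$ with $s(y)=m$, let $T^y_0,\dots,T^y_m$ be the children of $y$ from left to right, where "child" means the whole subtree; a child is empty if it is just a leaf. $T^y_0$ is the left child and $T^y_m$ the right child. A descendant of $y$ is a node lying in one of the $T^y_i$. Tree-inversions: for nodes $a<c$, $\#_T(c,a)$ is $0$ if $a$ is left of $c$ or belongs to $T^c_0$; it is $i$ if $a$ belongs to $T^c_i$ with $0<i<s(c)$; it is $s(c)$ if $a$ belongs to $T^c_{s(c)}$ or is right of $c$. $\operatorname{inv}(T)$ is the multi-set in which $(c,a)$ occurs $\#_T(c,a)$ times; it determines $T$. The $s$-weak order: $R\preccurlyeq T$ iff $\#_R(c,a)\le \#_T(c,a)$ for all $a<c$. Intervals are $[T_1,T_2]=\{R: T_1\preccurlyeq R\preccurlyeq T_2\}$. Transitive closure: for a multi-set $I$ of pairs $(c,a)$, $a<c$, with multiplicities $\#_I(c,a)$,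 a transitivity path from $c$ to $a$ is a list $c=b_1>\dots>b_k=a$, $k\ge2$, with $\#_I(b_i,b_{i+1})>0$ for all $i$; $\#_{I^{\mathsf{tc}}}(c,a)$ is the maximal value of $\#_I(b_1,b_2)$ over all such paths (and $0$ if there is none). A pair $(a,c)$ with $a<c$ is a tree-ascent of $T$ if: (i) $a$ is a descendant of $c$; (ii) $a$ does not belong to the right child of $c$; (iii) whenever $c>b>a$ and $a$ is a descendant of $b$, $a$ belongs to the right child of $b$; (iv) if $s(a)>0$, the right child of $a$ is empty. For a (possibly empty) set $A$ of tree-ascents of $T$, $T+A$ is the $s$-decreasing tree whose multi-set of tree-inversions is obtained from $\operatorname{inv}(T)$ by increasing $\#_T(c,a)$ by one for every $(a,c)\in A$ and then taking the transitive closure. A pure interval is an interval of the form $[T,T+A]$. The $s$-permutahedron $\operatorname{Perm}(s)$ is the collection of all pure intervals $[T,T+A]$ (its faces); the dimension of $[T,T+A]$ is $|A|$. -}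

module Defs where

open import Data.Bool.Base using (if_then_else_)
open import Data.Fin.Base using (Fin; zero; suc; toℕ; fromℕ) renaming (_<_ to _<ᶠ_)
open import Data.Fin.Properties using (all?; any?) renaming (_≟_ to _≟ᶠ_; _<?_ to _<ᶠ?_)
open import Data.List.Base
  using (List; []; _∷_; length; map; foldr; filter; allFin; cartesianProduct)
open import Data.List.Relation.Unary.All using (All)
open import Data.List.Relation.Unary.Unique.Propositional using (Unique)
import Data.List.Membership.DecPropositional as DecMembership
import Data.List.Relation.Unary.Enumerates.Setoid as Enumerates
import Data.List.Relation.Unary.Unique.Setoid as UniqueSetoid
open import Data.Nat.Base using (ℕ; zero; suc; _+_; _*_; _≤_; _<_)
open import Data.Nat.Properties using () renaming (_<?_ to _<ⁿ?_)
open import Data.Product.Base using (Σ; ∃; ∃-syntax; _×_; _,_; proj₁; proj₂)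
open import Data.Product.Properties using (≡-dec)
open import Data.Sum.Base using (_⊎_)
open import Data.Vec.Base using (Vec; []; _∷_; lookup)
open import Data.Vec.Functional using (Vector)
open import Function.Definitions using (Bijective)
open import Level using (0ℓ)
open import Relation.Binary.Bundles using (Setoid)
import Relation.Binary.Construct.On as On
open import Relation.Binary.PropositionalEquality using (_≡_; refl; setoid)
open import Relation.Nullary using (Dec; yes; no; does; ¬_)
open import Relation.Nullary.Decidable using (¬?; _×-dec_; _→-dec_; map′)
open import Relation.Unary using (Pred; Decidable)
open import Relation.Unary.Relation.Binary.Equality using (≐-setoid)

-- Lists of coefficients, lowest degree first.
-- Trailing zeros are allowed, so equality is _≈ₚ_ rather than _≡_.

Poly : Set
Poly = List ℕ

coeff : Poly → ℕ → ℕ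
coeff []      _       = 0
coeff (a ∷ _) zero    = a
coeff (_ ∷ p) (suc k) = coeff p k

infix  4 _≈ₚ_
infixl 6 _+ₚ_
infixl 7 _*ₚ_
infixr 8 _^ₚ_

_≈ₚ_ : Poly → Poly → Set
p ≈ₚ q = ∀ k → coeff p k ≡ coeff q k

_+ₚ_ : Poly → Poly → Poly
[]      +ₚ q       = q
(a ∷ p) +ₚ []      = a ∷ p
(a ∷ p) +ₚ (b ∷ q) = (a + b) ∷ (p +ₚ q)

_*ₚ_ : Poly → Poly → Poly
[]      *ₚ q = []
(a ∷ p) *ₚ q = map (a *_) q +ₚ (0 ∷ (p *ₚ q))

1ₚ t : Poly
1ₚ = 1 ∷ []
t  = 0 ∷ 1 ∷ []

_^ₚ_ : Poly → ℕ → Poly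
p ^ₚ zero  = 1ₚ
p ^ₚ suc k = p *ₚ (p ^ₚ k)

sumₚ : List Poly → Poly
sumₚ = foldr _+ₚ_ []

record Enumeration (S : Setoid 0ℓ 0ℓ) : Set where
  field
    elements : List (Setoid.Carrier S)
    complete : Enumerates.IsEnumeration S elements
    distinct : UniqueSetoid.Unique S elements

-- HasSum S f p says that S is finite and that Σ_{x ∈ S} f x is p.
-- Quantifying over all enumerations makes the sum independent of the
-- representatives chosen, even when f is not known to respect the
-- equality of S.
record HasSum (S : Setoid 0ℓ 0ℓ) (f : Setoid.Carrier S → Poly) (p : Poly) : Set where
  field
    finite : Enumeration S
    total  : (E : Enumeration S) → sumₚ (map f (Enumeration.elements E)) ≈ₚ p

-- The labels 1, …, n are represented by Fin n.

WeakComposition : ℕ → Set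
WeakComposition n = Vector ℕ n

data PlanarTree {n} (s : WeakComposition n) : Set where
  leaf : PlanarTree s
  node : (i : Fin n) → Vec (PlanarTree s) (suc (s i)) → PlanarTree s

module _ {n} {s : WeakComposition n} where

  -- An element of u ⊑ t is an occurrence of u in t, given by the path
  -- from the root of t; in particular u ⊑ t may have several elements.
  infix 4 _⊑_ _∈ᵗ_
  data _⊑_ (u : PlanarTree s) : PlanarTree s → Set where
    here  : u ⊑ u
    child : ∀ {i us} j → u ⊑ lookup us j → u ⊑ node i us

  Node : PlanarTree s → Set
  Node t = Σ (Fin n) λ i → ∃[ us ] node i us ⊑ t

  label : ∀ {t} → Node t → Fin n
  label = proj₁

  HasNode : PlanarTree s → (c : Fin n) → (Vec (PlanarTree s) (suc (s c)) → Set) → Set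
  HasNode t c Q = ∃[ us ] (node c us ⊑ t × Q us)

  _∈ᵗ_ : Fin n → PlanarTree s → Set
  a ∈ᵗ t = ∃[ us ] node a us ⊑ t

  Decreasing : PlanarTree s → Set
  Decreasing t = ∀ {c us} → node c us ⊑ t → ∀ j {a} → a ∈ᵗ lookup us j → a <ᶠ c

  -- a belongs to T^c_i; here T^c_0, …, T^c_{s(c)} are indexed by Fin (s(c) + 1).
  InChild : PlanarTree s → (c : Fin n) → Fin (suc (s c)) → Fin n → Set
  InChild t c i a = HasNode t c λ us → a ∈ᵗ lookup us i

  Descendant : PlanarTree s → Fin n → Fin n → Set
  Descendant t c a = ∃[ i ] InChild t c i a

  right : (c : Fin n) → Fin (suc (s c))
  right c = fromℕ (s c)

  InRightChild : PlanarTree s → Fin n → Fin n → Set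
  InRightChild t c a = InChild t c (right c) a

  RightChildEmpty : PlanarTree s → Fin n → Set
  RightChildEmpty t c = HasNode t c λ us → lookup us (right c) ≡ leaf

  LeftOf : PlanarTree s → Fin n → Fin n → Set
  LeftOf t a c = ∃[ b ] ∃[ j ] ∃[ k ] (j <ᶠ k ×
    HasNode t b λ us → a ∈ᵗ lookup us j × c ∈ᵗ lookup us k)

  hasNode?  : ∀ {c Q} → (∀ us → Dec (Q us)) → ∀ t → Dec (HasNode t c Q)
  hasNodes? : ∀ {c Q m} → (∀ us → Dec (Q us)) → (ts : Vec (PlanarTree s) m) →
              ∀ j → Dec (HasNode (lookup ts j) c Q)

  hasNode? Q? leaf = no λ { (_ , () , _) }
  hasNode? {c} Q? (node b ts) with any? (hasNodes? Q? ts)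
  ... | yes (j , us , p , q) = yes (us , child j p , q)
  ... | no ¬below with c ≟ᶠ b
  ...   | no c≢b = no λ { (_ , here , _)        → c≢b refl
                        ; (us , child j p , q) → ¬below (j , us , p , q) }
  ...   | yes refl with Q? ts
  ...     | yes q = yes (ts , here , q)
  ...     | no ¬q = no λ { (_ , here , q)        → ¬q q
                         ; (us , child j p , q) → ¬below (j , us , p , q) }

  hasNodes? Q? (t ∷ ts) zero    = hasNode? Q? t
  hasNodes? Q? (t ∷ ts) (suc j) = hasNodes? Q? ts j

  _∈ᵗ?_ : ∀ a t → Dec (a ∈ᵗ t)
  a ∈ᵗ? t = map′ (λ (us , p , _) → us , p) (λ (us , p) → us , p , refl)
                 (hasNode? {Q = λ _ → 0 ≡ 0} (λ _ → yes refl) t)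

  isLeaf? : ∀ (t : PlanarTree s) → Dec (t ≡ leaf)
  isLeaf? leaf       = yes refl
  isLeaf? (node _ _) = no λ ()

  inChild? : ∀ t c i a → Dec (InChild t c i a)
  inChild? t c i a = hasNode? (λ us → a ∈ᵗ? lookup us i) t

  descendant? : ∀ t c a → Dec (Descendant t c a)
  descendant? t c a = any? λ i → inChild? t c i a

  leftOf? : ∀ t a c → Dec (LeftOf t a c)
  leftOf? t a c = any? λ b → any? λ j → any? λ k → (j <ᶠ? k) ×-dec
    hasNode? (λ us → (a ∈ᵗ? lookup us j) ×-dec (c ∈ᵗ? lookup us k)) t

  -- The number #_T(c,a), meaningful for a < c only.  In an s-decreasing
  -- tree such an a is a descendant of c, or right of c, or left of c; these
  -- are the three branches, in this order.
  # : PlanarTree s → Fin n → Fin n → ℕ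
  # t c a with descendant? t c a
  ... | yes (i , _) = toℕ i
  ... | no  _ with leftOf? t c a
  ...   | yes _ = s c
  ...   | no  _ = 0

  record IsTreeAscent (t : PlanarTree s) (ac : Fin n × Fin n) : Set where
    constructor isTreeAscent
    private
      a = proj₁ ac
      c = proj₂ ac
    field
      a<c         : a <ᶠ c
      descendant  : Descendant t c a
      notRight    : ¬ InRightChild t c a
      rightBelow  : ∀ b → b <ᶠ c → a <ᶠ b → Descendant t b a → InRightChild t b a
      rightEmpty  : 0 < s a → RightChildEmpty t a

  isTreeAscent? : ∀ t → Decidable (IsTreeAscent t)
  isTreeAscent? t (a , c) =
    map′ (λ (p , q , r , u , v) → isTreeAscent p q r u v)
         (λ (isTreeAscent p q r u v) → p , q , r , u , v)
         ((a <ᶠ? c)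
           ×-dec descendant? t c a
           ×-dec ¬? (inChild? t c (right c) a)
           ×-dec all? (λ b → (b <ᶠ? c) →-dec (a <ᶠ? b) →-dec
                   descendant? t b a →-dec inChild? t b (right b) a)
           ×-dec ((0 <ⁿ? s a) →-dec hasNode? (λ us → isLeaf? (lookup us (right a))) t))

  asc : PlanarTree s → ℕ
  asc t = length (filter (isTreeAscent? t) (cartesianProduct (allFin n) (allFin n)))

record DecreasingTree {n} (s : WeakComposition n) : Set where
  field
    tree       : PlanarTree s
    labelling  : Bijective _≡_ _≡_ (label {t = tree})
    decreasing : Decreasing tree

open DecreasingTree public using (tree)

Trees : ∀ {n} → WeakComposition n → Setoid 0ℓ 0ℓ
Trees s = On.setoid (setoid (PlanarTree s)) (tree {s = s})

-- Multi-sets of pairs (c , a) with a < c, given by their multiplicities;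
-- the values at pairs with a ≮ c are ignored.

Multiset : ℕ → Set
Multiset n = Fin n → Fin n → ℕ

data TransitivityPath {n} (I : Multiset n) (c a : Fin n) : Set where
  last : a <ᶠ c → 0 < I c a → TransitivityPath I c a
  step : ∀ b → b <ᶠ c → 0 < I c b → TransitivityPath I b a → TransitivityPath I c a

-- #_I(b₁,b₂) for a path b₁ > b₂ > …
first : ∀ {n} {I : Multiset n} {c a} → TransitivityPath I c a → ℕ
first {I = I} {c} {a} (last _ _)     = I c a
first {I = I} {c} {a} (step b _ _ _) = I c b

-- m is the multiplicity of (c , a) in the transitive closure of I.
IsClosureMultiplicity : ∀ {n} → Multiset n → Fin n → Fin n → ℕ → Set
IsClosureMultiplicity I c a m =
  (¬ TransitivityPath I c a × m ≡ 0) ⊎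
  (∃[ p ] (first {I = I} {c} {a} p ≡ m × ∀ (q : TransitivityPath I c a) → first q ≤ m))

increase : ∀ {n} → Multiset n → List (Fin n × Fin n) → Multiset n
increase I A c a = I c a + (if does ((a , c) ∈? A) then 1 else 0)
  where open DecMembership (≡-dec _≟ᶠ_ _≟ᶠ_) using (_∈?_)

module _ {n} {s : WeakComposition n} where

  infix 4 _≼_
  _≼_ : DecreasingTree s → DecreasingTree s → Set
  R ≼ T = ∀ {a c} → a <ᶠ c → # (tree R) c a ≤ # (tree T) c a

  [_,_] : DecreasingTree s → DecreasingTree s → Pred (DecreasingTree s) 0ℓ
  [ T₁ , T₂ ] R = T₁ ≼ R × R ≼ T₂

  -- R is the tree T + A.
  IsSum : DecreasingTree s → List (Fin n × Fin n) → DecreasingTree s → Set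
  IsSum T A R = ∀ {a c} → a <ᶠ c →
    IsClosureMultiplicity (increase (# (tree T)) A) c a (# (tree R) c a)

-- A presentation of a pure interval [T , T + A], the set A being given as
-- a list without repetitions.
record PureInterval {n} (s : WeakComposition n) : Set where
  field
    bottom   : DecreasingTree s
    A        : List (Fin n × Fin n)
    A-unique : Unique A
    A-ascent : All (IsTreeAscent (tree bottom)) A
    top      : DecreasingTree s
    top-sum  : IsSum bottom A top

  interval : Pred (DecreasingTree s) 0ℓ
  interval = [ bottom , top ]

  dim : ℕ
  dim = length A

open PureInterval public using (interval; dim)

-- Two presentations are the same face when their intervals are the same
-- set of trees.
Perm : ∀ {n} → WeakComposition n → Setoid 0ℓ 0ℓ
Perm s = On.setoid (≐-setoid (DecreasingTree s) 0ℓ) (interval {s = s})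

IsFPolynomial : ∀ {n} → WeakComposition n → Poly → Set
IsFPolynomial s = HasSum (Perm s) (λ F → t ^ₚ dim F)

module Submission where

-- A face [T , T + A] determines T and A, and every set A of ascents of a
-- tree T gives a face.  Hence the faces correspond to the pairs (T , A), and
-- summing t^|A| over the subsets A of the asc T ascents of a fixed T gives
-- (1 + t)^(asc T).
--
-- T + A exists.  The tree-inversions of s-decreasing trees are exactly the
-- multisets that are bounded by s, transitive and planar (IsInversion): those
-- of a tree are (#-isInversion), and conversely a tree is read off such a
-- multiset from the root downwards, the multiplicity of (r , a) telling in
-- which child of the root r the label a lies (inversion-tree).  Adding A to
-- the tree-inversions of T may destroy transitivity, but it keeps them bounded
-- and planar (increase-planar), because an ascent a of c sits on the right
-- spine of a child of c (ascent-planar).  Transitive closure restores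
-- transitivity and preserves planarity: a path from c to a either can be
-- diverted to b, or reveals that (b , a) has the maximal multiplicity s b, for
-- every b between a and c (cross, closure-isInversion).
--
-- T and A are determined.  T and T + A are the least and the greatest element
-- of the interval, and a tree is determined by its tree-inversions
-- (#-determines).  An ascent (a , c) of T belongs to A exactly when its
-- multiplicity in T + A exceeds the one in T (∈⇒increased, increased⇒∈): a
-- path through another ascent (d , c) of A cannot raise it, since the right
-- child of d is empty if s d > 0 (ascents-apart, no-gain).
--
-- Counting.  A sum over a finite setoid does not depend on the enumeration
-- (sum-enumerations), so it suffices to sum over one enumeration of the trees,
-- and over the faces arising from it and from the sublists of the lists of
-- ascents (treeEnumeration, faceEnumeration, binomial).

open import Defs
open import Data.Nat.Base using (ℕ)
open import Data.Product.Base using (∃-syntax; _×_)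

open import Algebra.Properties.CommutativeSemigroup using (x∙yz≈y∙xz)
open import Data.Fin.Base using (Fin; zero; suc; toℕ; fromℕ<; opposite) renaming (_<_ to _<ᶠ_)
open import Data.Fin.Induction using (<-wellFounded)
open import Data.Fin.Properties
  using (toℕ-injective; toℕ-fromℕ; toℕ-fromℕ<; toℕ≤pred[n]; toℕ<n; any?; all?; opposite-prop; opposite-involutive)
  renaming (<-cmp to <ᶠ-cmp; <-irrefl to <ᶠ-irrefl; <-asym to <ᶠ-asym; <-trans to <ᶠ-trans; _<?_ to _<ᶠ?_; _≟_ to _≟ᶠ_)
open import Data.List.Base as List
  using (List; []; _∷_; _++_; map; length; filter; concatMap; cartesianProductWith; cartesianProduct; allFin; upTo; deduplicate)
open import Data.List.Properties using (map-++; map-∘; map-cong)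
import Data.List.Membership.DecPropositional as DecMembership
open import Data.List.Membership.Propositional using (_∈_; lose)
open import Data.List.Membership.Propositional.Properties
  using (∈-map⁺; ∈-++⁺ˡ; ∈-++⁺ʳ; ∈-tabulate⁺; ∈-cartesianProductWith⁺; ∈-cartesianProduct⁺; ∈-filter⁺; ∈-filter⁻; ∈-allFin; ∈-upTo⁺)
import Data.List.Membership.Setoid as SetoidMembership
import Data.List.Membership.Setoid.Properties as SetoidMembershipₚ
open import Data.List.Relation.Binary.Sublist.Propositional as Sublist using (_⊆_; []; _∷_; _∷ʳ_)
open import Data.List.Relation.Binary.Sublist.Propositional.Properties using (All-resp-⊆)
open import Data.List.Relation.Unary.All as All using (All; []; _∷_)
import Data.List.Relation.Unary.All.Properties as All
open import Data.List.Relation.Unary.AllPairs as AllPairs using (AllPairs; []; _∷_)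
import Data.List.Relation.Unary.AllPairs.Properties as AllPairs
open import Data.List.Relation.Unary.Any as Any using (Any; here; there; _─_)
import Data.List.Relation.Unary.Any.Properties as Any
import Data.List.Relation.Unary.Unique.DecSetoid.Properties as UniqueDecSetoid
open import Data.List.Relation.Unary.Unique.Propositional using (Unique)
import Data.List.Relation.Unary.Unique.Propositional.Properties as Unique
import Data.List.Relation.Unary.Unique.Setoid as UniqueSetoid
open import Data.Nat.Base using (zero; suc; _+_; _*_; _≤_; _<_; z≤n; s≤s)
open import Data.Nat.ListAction using (sum)
open import Data.Nat.ListAction.Properties using (sum-++)
open import Data.Nat.Properties
  using (≤-refl; ≤-reflexive; ≤-trans; ≤-antisym; ≤-total; ≤∧≢⇒<; <-irrefl; <⇒≤; <-≤-trans; ≤-<-trans; ≮⇒≥; n≢0⇒n>0; m≤m+n;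
         ∸-monoʳ-<; +-identityʳ; +-comm; +-monoʳ-≤; +-commutativeSemigroup; *-identityˡ; *-zeroʳ; _≤?_)
  renaming (_≟_ to _≟ⁿ_; _<?_ to _<ⁿ?_)
open import Data.Product.Base using (∃; _,_; proj₁; proj₂)
open import Data.Product.Properties using (≡-dec)
open import Data.Sum.Base using (_⊎_; inj₁; inj₂)
open import Data.Vec.Base as Vec using (Vec; []; _∷_; lookup)
open import Data.Vec.Properties using (lookup∘tabulate)
open import Data.Vec.Relation.Binary.Pointwise.Extensional using (ext; Pointwise-≡⇒≡)
open import Function.Base using (_∘_; id)
open import Induction.WellFounded using (Acc; acc)
open import Level using (0ℓ)
open import Relation.Binary.Bundles using (Setoid; DecSetoid)
open import Relation.Binary.Definitions using (tri<; tri≈; tri>)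
open import Relation.Binary.PropositionalEquality
  using (_≡_; refl; sym; trans; cong; cong₂; subst; subst₂; setoid; module ≡-Reasoning)
open import Relation.Nullary using (¬_; Dec; yes; no; contradiction)
open import Relation.Nullary.Decidable using (_×-dec_; _⊎-dec_; _→-dec_; map′)
open import Relation.Unary using (Pred; Decidable)


-- Trees with distinct decreasing labels

module _ {n : ℕ} {s : WeakComposition n} where

  private variable
    τ u v : PlanarTree s
    a b c d r : Fin n

  ⊑-trans : u ⊑ v → v ⊑ τ → u ⊑ τ
  ⊑-trans p here        = p
  ⊑-trans p (child j q) = child j (⊑-trans p q)

  ∈-child : ∀ {us} → node c us ⊑ τ → ∀ j → a ∈ᵗ lookup us j → a ∈ᵗ τ
  ∈-child p j (vs , q) = vs , ⊑-trans (child j q) p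

  InChild-⊑ : ∀ {i} → u ⊑ τ → InChild u c i a → InChild τ c i a
  InChild-⊑ q (us , p , a∈) = us , ⊑-trans p q , a∈

  LeftOf-⊑ : u ⊑ τ → LeftOf u a c → LeftOf τ a c
  LeftOf-⊑ q (b , j , k , j<k , us , p , ac) = b , j , k , j<k , us , ⊑-trans p q , ac

  ∈-node⁻ : ∀ {us : Vec (PlanarTree s) (suc (s r))} → a ∈ᵗ node r us → a ≡ r ⊎ ∃[ j ] a ∈ᵗ lookup us j
  ∈-node⁻ (_  , here)      = inj₁ refl
  ∈-node⁻ (vs , child j p) = inj₂ (j , vs , p)

  -- The trees all of whose subtrees have decreasing and pairwise distinct labels,
  -- described by recursion: the labels below a root r are smaller than r, and
  -- different children of r share no label.  Nothing is said about which labels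
  -- occur, so that subtrees of such trees are again of this kind.
  data Wf : PlanarTree s → Set where
    leaf : Wf leaf
    node : ∀ {us} → (∀ j → Wf (lookup us j)) →
           (∀ {j a} → a ∈ᵗ lookup us j → a <ᶠ r) →
           (∀ {j k a} → a ∈ᵗ lookup us j → a ∈ᵗ lookup us k → j ≡ k) →
           Wf (node r us)

  Wf-⊑ : Wf τ → u ⊑ τ → Wf u
  Wf-⊑ w            here        = w
  Wf-⊑ (node w _ _) (child j p) = Wf-⊑ (w j) p

  below : ∀ {us j} → Wf τ → node c us ⊑ τ → a ∈ᵗ lookup us j → a <ᶠ c
  below w p with Wf-⊑ w p
  ... | node _ d _ = d

  disjoint : ∀ {us j k} → Wf τ → node c us ⊑ τ → a ∈ᵗ lookup us j → a ∈ᵗ lookup us k → j ≡ k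
  disjoint w p with Wf-⊑ w p
  ... | node _ _ e = e

  occurrence-unique : ∀ {us vs} → Wf τ → (p : node c us ⊑ τ) (q : node c vs ⊑ τ) →
    _≡_ {A = c ∈ᵗ τ} (us , p) (vs , q)
  occurrence-unique w            here        here        = refl
  occurrence-unique (node _ d _) here        (child k q) = contradiction (d (_ , q)) (<ᶠ-irrefl refl)
  occurrence-unique (node _ d _) (child j p) here        = contradiction (d (_ , p)) (<ᶠ-irrefl refl)
  occurrence-unique (node w _ e) (child j p) (child k q) with e (_ , p) (_ , q)
  ... | refl = cong (λ (us , p) → us , child j p) (occurrence-unique (w j) p q)

  -- Induction on planar trees, with the hypothesis given for all children.
  tree-ind : (P : PlanarTree s → Set) → P leaf →
    (∀ i us → (∀ j → P (lookup us j)) → P (node i us)) → ∀ τ → P τ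
  tree-ind* : (P : PlanarTree s → Set) → P leaf →
    (∀ i us → (∀ j → P (lookup us j)) → P (node i us)) → ∀ {m} (ts : Vec (PlanarTree s) m) j → P (lookup ts j)
  tree-ind P l f leaf        = l
  tree-ind P l f (node i us) = f i us (tree-ind* P l f us)
  tree-ind* P l f (τ ∷ ts) zero    = tree-ind P l f τ
  tree-ind* P l f (τ ∷ ts) (suc j) = tree-ind* P l f ts j

  -- A node of a child, regarded as a node of the whole tree.
  down : ∀ {us : Vec (PlanarTree s) (suc (s r))} j → Node (lookup us j) → Node (node r us)
  down j (i , vs , p) = i , vs , child j p

  down-injective : ∀ {us : Vec (PlanarTree s) (suc (s r))} {j} (x y : Node (lookup us j)) → down {r} {us} j x ≡ down j y → x ≡ y
  down-injective _ _ refl = refl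

  down-disjoint : ∀ {us : Vec (PlanarTree s) (suc (s r))} {j k} (x : Node (lookup us j)) (y : Node (lookup us k)) →
    down {r} {us} j x ≡ down k y → j ≡ k
  down-disjoint _ _ refl = refl

  decreasing⇒Wf : ∀ τ → Decreasing τ → (∀ {x y : Node τ} → proj₁ x ≡ proj₁ y → x ≡ y) → Wf τ
  decreasing⇒Wf = tree-ind _ (λ _ _ → leaf) λ i us ih d inj → node
    (λ j → ih j (λ p → d (child j p)) (λ {x} {y} eq → down-injective x y (inj eq)))
    (λ {j} → d here j)
    (λ {j} {k} (us , p) (vs , q) → down-disjoint (_ , us , p) (_ , vs , q) (inj refl))

  -- Every label occurs.
  Full : PlanarTree s → Set
  Full τ = ∀ a → a ∈ᵗ τ

  Wf⇒DecreasingTree : ∀ τ → Wf τ → Full τ → DecreasingTree s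
  Wf⇒DecreasingTree τ w f = record
    { tree       = τ
    ; labelling  = (λ { {_ , _ , p} {_ , _ , q} refl → cong (_ ,_) (occurrence-unique w p q) })
                 , λ a → (a , f a) , λ { refl → refl }
    ; decreasing = λ p j → below w p
    }

  wf : (T : DecreasingTree s) → Wf (tree T)
  wf T = decreasing⇒Wf (tree T) (DecreasingTree.decreasing T) (proj₁ (DecreasingTree.labelling T))

  full : (T : DecreasingTree s) → Full (tree T)
  full T a with proj₂ (DecreasingTree.labelling T) a
  ... | (_ , o) , eq with eq refl
  ...   | refl = o

  -- Relative position of two labels

  -- The three relative positions of labels a < c.  They exclude each other, which
  -- makes them determine # (#-InChild, #-rightOf, #-leftOf).
  comparable : Wf τ → a ∈ᵗ τ → c ∈ᵗ τ → a <ᶠ c →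
    Descendant τ c a ⊎ LeftOf τ c a ⊎ LeftOf τ a c
  comparable {τ = node r us} (node w d e) a∈ c∈ a<c with ∈-node⁻ a∈ | ∈-node⁻ c∈
  ... | inj₁ refl     | inj₁ refl     = contradiction a<c (<ᶠ-irrefl refl)
  ... | inj₁ refl     | inj₂ (k , c∈′) = contradiction a<c (<ᶠ-asym (d c∈′))
  ... | inj₂ (j , a∈′) | inj₁ refl     = inj₁ (j , us , here , a∈′)
  ... | inj₂ (j , a∈′) | inj₂ (k , c∈′) with <ᶠ-cmp j k
  ...   | tri< j<k _ _  = inj₂ (inj₂ (r , j , k , j<k , us , here , a∈′ , c∈′))
  ...   | tri> _ _ k<j  = inj₂ (inj₁ (r , k , j , k<j , us , here , c∈′ , a∈′))
  ...   | tri≈ _ refl _ with comparable (w j) a∈′ c∈′ a<c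
  ...     | inj₁ (i , p)    = inj₁ (i , InChild-⊑ (child j here) p)
  ...     | inj₂ (inj₁ p)   = inj₂ (inj₁ (LeftOf-⊑ (child j here) p))
  ...     | inj₂ (inj₂ p)   = inj₂ (inj₂ (LeftOf-⊑ (child j here) p))

  InChild-same : ∀ {i us} → Wf τ → InChild τ c i a → node c us ⊑ τ → a ∈ᵗ lookup us i
  InChild-same w (vs , p , a∈) q with occurrence-unique w p q
  ... | refl = a∈

  InChild-unique : ∀ {i j} → Wf τ → InChild τ c i a → InChild τ c j a → i ≡ j
  InChild-unique w x (us , p , a∈) = disjoint w p (InChild-same w x p) a∈

  -- A subtree containing c contains all descendants of c.
  ∈-desc : Wf τ → Descendant τ c a → u ⊑ τ → c ∈ᵗ u → a ∈ᵗ u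
  ∈-desc w (i , x) q (us , p) = ∈-child p i (InChild-same w x (⊑-trans p q))

  LeftOf-descˡ : Wf τ → Descendant τ c a → LeftOf τ c b → LeftOf τ a b
  LeftOf-descˡ w x (e , j , k , j<k , us , p , c∈ , b∈) =
    e , j , k , j<k , us , p , ∈-desc w x (⊑-trans (child j here) p) c∈ , b∈

  LeftOf-descʳ : Wf τ → Descendant τ c a → LeftOf τ b c → LeftOf τ b a
  LeftOf-descʳ w x (e , j , k , j<k , us , p , b∈ , c∈) =
    e , j , k , j<k , us , p , b∈ , ∈-desc w x (⊑-trans (child k here) p) c∈

  LeftOf-irrefl : Wf τ → ¬ LeftOf τ a a
  LeftOf-irrefl w (e , j , k , j<k , us , p , x , y) = <ᶠ-irrefl (disjoint w p x y) j<k

  -- The node where a and c part is either r or inside a single child of r.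
  LeftOf-split : ∀ {us} → Wf (node r us) → LeftOf (node r us) a c →
    ∃[ j ] ∃[ k ] (a ∈ᵗ lookup us j × c ∈ᵗ lookup us k ×
      (j <ᶠ k ⊎ (j ≡ k × LeftOf (lookup us j) a c)))
  LeftOf-split w (_ , j , k , j<k , us , here , x , y) = j , k , x , y , inj₁ j<k
  LeftOf-split w (b , j , k , j<k , us , child i p , x , y) =
    i , i , ∈-child p j x , ∈-child p k y , inj₂ (refl , b , j , k , j<k , us , p , x , y)

  LeftOf-node⁻ : ∀ {us j k} → Wf (node r us) → LeftOf (node r us) a c →
    a ∈ᵗ lookup us j → c ∈ᵗ lookup us k → j <ᶠ k ⊎ (j ≡ k × LeftOf (lookup us j) a c)
  LeftOf-node⁻ w@(node _ _ e) l a∈ c∈ with LeftOf-split w l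
  ... | j , k , x , y , z with e x a∈ | e y c∈
  ...   | refl | refl = z

  LeftOf-trans : Wf τ → LeftOf τ a b → LeftOf τ b c → LeftOf τ a c
  LeftOf-trans w@(node _ _ e) (r , j , k , j<k , us , here , x , y) l with LeftOf-split w l
  ... | _ , k′ , y′ , z , l′ with e y y′
  LeftOf-trans w (r , j , k , j<k , us , here , x , y) l | _ , k′ , y′ , z , inj₁ k<k′ | refl =
    r , j , k′ , <ᶠ-trans j<k k<k′ , us , here , x , z
  LeftOf-trans w (r , j , k , j<k , us , here , x , y) l | _ , _ , y′ , z , inj₂ (refl , _) | refl =
    r , j , k , j<k , us , here , x , z
  LeftOf-trans w@(node w′ _ e) (d , j , k , j<k , us , child i p , x , y) l with LeftOf-split w l
  ... | _ , k′ , y′ , z , l′ with e (∈-child p k y) y′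
  LeftOf-trans w (d , j , k , j<k , us , child i p , x , y) l | _ , k′ , y′ , z , inj₁ i<k′ | refl =
    _ , i , k′ , i<k′ , _ , here , ∈-child p j x , z
  LeftOf-trans (node w′ _ _) (d , j , k , j<k , us , child i p , x , y) l | _ , _ , y′ , z , inj₂ (refl , l′) | refl =
    LeftOf-⊑ (child i here) (LeftOf-trans (w′ i) (d , j , k , j<k , us , p , x , y) l′)

  LeftOf⇒∈ : LeftOf τ a b → a ∈ᵗ τ × b ∈ᵗ τ
  LeftOf⇒∈ (_ , j , k , _ , us , p , x , y) = ∈-child p j x , ∈-child p k y

  -- Labels in a common child part inside that child.
  LeftOf-restrict : ∀ {us i} → Wf τ → node c us ⊑ τ → a ∈ᵗ lookup us i → b ∈ᵗ lookup us i →
    LeftOf τ a b → LeftOf (lookup us i) a b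
  LeftOf-restrict w here a∈ b∈ l with LeftOf-node⁻ w l a∈ b∈
  ... | inj₁ i<i     = contradiction i<i (<ᶠ-irrefl refl)
  ... | inj₂ (_ , x) = x
  LeftOf-restrict w@(node w′ _ _) (child j p) a∈ b∈ l
    with LeftOf-node⁻ w l (∈-child p _ a∈) (∈-child p _ b∈)
  ... | inj₁ i<i     = contradiction i<i (<ᶠ-irrefl refl)
  ... | inj₂ (_ , x) = LeftOf-restrict (w′ j) p a∈ b∈ x

  LeftOf-asym : Wf τ → LeftOf τ a b → ¬ LeftOf τ b a
  LeftOf-asym w (e , j , k , j<k , us , here , x , y) l with LeftOf-node⁻ w l y x
  ... | inj₁ k<j        = <ᶠ-asym j<k k<j
  ... | inj₂ (refl , _) = <ᶠ-irrefl refl j<k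
  LeftOf-asym w@(node w′ _ _) (e , j , k , j<k , us , child i p , x , y) l
    with LeftOf-node⁻ w l (∈-child p k y) (∈-child p j x)
  ... | inj₁ i<i      = <ᶠ-irrefl refl i<i
  ... | inj₂ (_ , l′) = LeftOf-asym (w′ i) (e , j , k , j<k , us , p , x , y) l′

  -- Tree-inversions

  #-InChild : ∀ {i} → Wf τ → InChild τ c i a → # τ c a ≡ toℕ i
  #-InChild {τ = τ} {c = c} {a = a} w x with descendant? τ c a
  ... | yes (_ , y) = cong toℕ (InChild-unique w y x)
  ... | no ¬x       = contradiction (_ , x) ¬x

  -- Labels right of c have multiplicity s c, labels left of c multiplicity 0.
  #-rightOf : Wf τ → LeftOf τ c a → # τ c a ≡ s c
  #-rightOf {τ = τ} {c = c} {a = a} w l with descendant? τ c a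
  ... | yes x = contradiction (LeftOf-descˡ w x l) (LeftOf-irrefl w)
  ... | no _ with leftOf? τ c a
  ...   | yes _ = refl
  ...   | no ¬l = contradiction l ¬l

  #-leftOf : Wf τ → LeftOf τ a c → # τ c a ≡ 0
  #-leftOf {τ = τ} {a = a} {c = c} w l with descendant? τ c a
  ... | yes x = contradiction (LeftOf-descʳ w x l) (LeftOf-irrefl w)
  ... | no _ with leftOf? τ c a
  ...   | yes l′ = contradiction l′ (LeftOf-asym w l)
  ...   | no _   = refl

  #-bounded : ∀ τ c a → # τ c a ≤ s c
  #-bounded τ c a with descendant? τ c a
  ... | yes (i , _) = toℕ≤pred[n] i
  ... | no _ with leftOf? τ c a
  ...   | yes _ = ≤-refl
  ...   | no _  = z≤n

  -- In a subtree, # has the same values as in the whole tree.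
  #-⊑ : Wf τ → u ⊑ τ → a ∈ᵗ u → c ∈ᵗ u → a <ᶠ c → # τ c a ≡ # u c a
  #-⊑ w p a∈ c∈ a<c with comparable (Wf-⊑ w p) a∈ c∈ a<c
  ... | inj₁ (i , x)  = trans (#-InChild w (InChild-⊑ p x)) (sym (#-InChild (Wf-⊑ w p) x))
  ... | inj₂ (inj₁ l) = trans (#-rightOf w (LeftOf-⊑ p l)) (sym (#-rightOf (Wf-⊑ w p) l))
  ... | inj₂ (inj₂ l) = trans (#-leftOf w (LeftOf-⊑ p l)) (sym (#-leftOf (Wf-⊑ w p) l))

  -- From above, a descendant of b is seen in the same position as b.
  #-desc : Wf τ → Descendant τ b a → b ∈ᵗ τ → c ∈ᵗ τ → b <ᶠ c → # τ c a ≡ # τ c b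
  #-desc w x b∈ c∈ b<c with comparable w b∈ c∈ b<c
  ... | inj₁ (i , us , p , b∈us) =
    trans (#-InChild w (us , p , ∈-desc w x (⊑-trans (child i here) p) b∈us)) (sym (#-InChild w (us , p , b∈us)))
  ... | inj₂ (inj₁ l) = trans (#-rightOf w (LeftOf-descʳ w x l)) (sym (#-rightOf w l))
  ... | inj₂ (inj₂ l) = trans (#-leftOf w (LeftOf-descˡ w x l)) (sym (#-leftOf w l))

  InChild-≤ : ∀ {i j} → Wf τ → InChild τ c i a → InChild τ c j b → LeftOf τ a b → toℕ i ≤ toℕ j
  InChild-≤ {i = i} {j} w (us , p , x) y l with <ᶠ-cmp i j
  ... | tri< i<j _ _  = <⇒≤ i<j
  ... | tri≈ _ refl _ = ≤-refl
  ... | tri> _ _ j<i  = contradiction (_ , j , i , j<i , us , p , InChild-same w y p , x) (LeftOf-asym w l)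

  -- For fixed c, the multiplicity grows weakly from left to right.
  #-LeftOf-mono : Wf τ → c ∈ᵗ τ → a <ᶠ c → b <ᶠ c → LeftOf τ a b → # τ c a ≤ # τ c b
  #-LeftOf-mono {τ = τ} {c = c} {a = a} {b = b} w c∈ a<c b<c l
    with comparable w (proj₁ (LeftOf⇒∈ l)) c∈ a<c | comparable w (proj₂ (LeftOf⇒∈ l)) c∈ b<c
  ... | inj₂ (inj₂ x) | _             = subst (_≤ # τ c b) (sym (#-leftOf w x)) z≤n
  ... | _             | inj₂ (inj₁ y) = subst (# τ c a ≤_) (sym (#-rightOf w y)) (#-bounded τ c a)
  ... | inj₁ (i , x)  | inj₁ (j , y)  =
    subst₂ _≤_ (sym (#-InChild w x)) (sym (#-InChild w y)) (InChild-≤ w x y l)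
  ... | inj₁ x        | inj₂ (inj₂ y) = contradiction (LeftOf-descʳ w x y) (LeftOf-asym w l)
  ... | inj₂ (inj₁ x) | inj₁ y        = contradiction (LeftOf-descˡ w y x) (LeftOf-asym w l)
  ... | inj₂ (inj₁ x) | inj₂ (inj₂ y) = contradiction (LeftOf-trans w y x) (LeftOf-asym w l)

  -- The conditions characterising the multisets of tree-inversions.  They are
  -- conditions on the multiplicities of pairs (c , a) with a < c only.
  record IsInversion (J : Multiset n) : Set where
    field
      bounded    : a <ᶠ c → J c a ≤ s c
      transitive : a <ᶠ b → b <ᶠ c → J b a ≡ 0 ⊎ J c b ≤ J c a
      planar     : a <ᶠ b → b <ᶠ c → J b a ≡ s b ⊎ J c a ≤ J c b

  #-isInversion : Wf τ → Full τ → IsInversion (# τ)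
  #-isInversion {τ = τ} w f = record
    { bounded    = λ {a} {c} _ → #-bounded τ c a
    ; transitive = λ {a} {b} {c} a<b b<c → case-trans a<b b<c
    ; planar     = λ {a} {b} {c} a<b b<c → case-planar a<b b<c
    }
    where
    case-trans : a <ᶠ b → b <ᶠ c → # τ b a ≡ 0 ⊎ # τ c b ≤ # τ c a
    case-trans {a} {b} {c} a<b b<c with comparable w (f a) (f b) a<b
    ... | inj₁ x        = inj₂ (≤-reflexive (sym (#-desc w x (f b) (f c) b<c)))
    ... | inj₂ (inj₁ l) = inj₂ (#-LeftOf-mono w (f c) b<c (<ᶠ-trans a<b b<c) l)
    ... | inj₂ (inj₂ l) = inj₁ (#-leftOf w l)
    case-planar : a <ᶠ b → b <ᶠ c → # τ b a ≡ s b ⊎ # τ c a ≤ # τ c b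
    case-planar {a} {b} {c} a<b b<c with comparable w (f a) (f b) a<b
    ... | inj₁ x        = inj₂ (≤-reflexive (#-desc w x (f b) (f c) b<c))
    ... | inj₂ (inj₁ l) = inj₁ (#-rightOf w l)
    ... | inj₂ (inj₂ l) = inj₂ (#-LeftOf-mono w (f c) (<ᶠ-trans a<b b<c) b<c l)

  -- The value of # at the root tells in which child a label lies.
  child-of : ∀ {us j} → Wf (node r us) → a ∈ᵗ node r us → a <ᶠ r → # (node r us) r a ≡ toℕ j → a ∈ᵗ lookup us j
  child-of {us = us} w a∈ a<r eq with ∈-node⁻ a∈
  ... | inj₁ refl    = contradiction a<r (<ᶠ-irrefl refl)
  ... | inj₂ (k , x) = subst (λ k → _ ∈ᵗ lookup us k) (toℕ-injective (trans (sym (#-InChild w (us , here , x))) eq)) x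

  -- Two trees with the same labels and the same tree-inversions are equal.  The
  -- largest label is the root of both, and # at the root distributes the
  -- remaining labels among the children.
  #-injective : Wf u → Wf v → (∀ {a} → a ∈ᵗ u → a ∈ᵗ v) → (∀ {a} → a ∈ᵗ v → a ∈ᵗ u) →
    (∀ {a c} → a ∈ᵗ u → c ∈ᵗ u → a <ᶠ c → # u c a ≡ # v c a) → u ≡ v
  #-injective leaf leaf _ _ _ = refl
  #-injective leaf (node _ _ _) _ g _ with g (_ , here)
  ... | _ , ()
  #-injective (node _ _ _) leaf f _ _ with f (_ , here)
  ... | _ , ()
  #-injective wu@(node {us = us} w d e) wv@(node {us = vs} w′ d′ e′) f g h
    with ∈-node⁻ (f (_ , here)) | ∈-node⁻ (g (_ , here))
  ... | inj₂ (_ , x) | inj₁ refl    = contradiction (d′ x) (<ᶠ-irrefl refl)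
  ... | inj₂ (_ , x) | inj₂ (_ , y) = contradiction (d y) (<ᶠ-asym (d′ x))
  ... | inj₁ refl    | _ = cong (node _) (Pointwise-≡⇒≡ (ext λ j → #-injective (w j) (w′ j) (f′ j) (g′ j) (h′ j)))
    where
    f′ : ∀ j {a} → a ∈ᵗ lookup us j → a ∈ᵗ lookup vs j
    f′ j x = child-of wv (f (∈-child here j x)) (d x)
      (trans (sym (h (∈-child here j x) (_ , here) (d x))) (#-InChild wu (us , here , x)))
    g′ : ∀ j {a} → a ∈ᵗ lookup vs j → a ∈ᵗ lookup us j
    g′ j x = child-of wu (g (∈-child here j x)) (d′ x)
      (trans (h (g (∈-child here j x)) (_ , here) (d′ x)) (#-InChild wv (vs , here , x)))
    h′ : ∀ j {a c} → a ∈ᵗ lookup us j → c ∈ᵗ lookup us j → a <ᶠ c → # (lookup us j) c a ≡ # (lookup vs j) c a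
    h′ j x y a<c = trans (sym (#-⊑ wu (child j here) x y a<c))
      (trans (h (∈-child here j x) (∈-child here j y) a<c) (#-⊑ wv (child j here) (f′ j x) (f′ j y) a<c))

  #-determines : (T U : DecreasingTree s) → (∀ {a c} → a <ᶠ c → # (tree T) c a ≡ # (tree U) c a) → tree T ≡ tree U
  #-determines T U h = #-injective (wf T) (wf U) (λ _ → full U _) (λ _ → full T _) (λ _ _ → h)

  -- Tree-ascents

  module _ (w : Wf τ) where

    ascent-< : IsTreeAscent τ (a , c) → # τ c a < s c
    ascent-< {a} {c} α with IsTreeAscent.descendant α
    ... | i , x = ≤∧≢⇒< (#-bounded τ c a) λ eq → IsTreeAscent.notRight α
      (subst (λ i → InChild τ c i a)
        (toℕ-injective (trans (sym (#-InChild w x)) (trans eq (sym (toℕ-fromℕ (s c)))))) x)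

    -- An ascent a of c lies on the right spine of its child of c, so that no label
    -- of this child is right of a.  A label b right of a would part from a at a node
    -- e below c, and a would not be in the right child of e.
    ascent-rightmost : ∀ {us i} → IsTreeAscent τ (a , c) → node c us ⊑ τ →
      a ∈ᵗ lookup us i → b ∈ᵗ lookup us i → ¬ LeftOf τ a b
    ascent-rightmost α p a∈ b∈ l with LeftOf-restrict w p a∈ b∈ l
    ... | e , j , k , j<k , vs , q , x , y = <ᶠ-irrefl refl (≤-trans j<k (subst (toℕ k ≤_) (sym j≡s) (toℕ≤pred[n] k)))
      where
      z : InChild τ e j _
      z = InChild-⊑ (⊑-trans (child _ here) p) (vs , q , x)
      j≡s : toℕ j ≡ s e
      j≡s = trans (cong toℕ (InChild-unique w z
              (IsTreeAscent.rightBelow α e (below w p (vs , q)) (below w (⊑-trans q (⊑-trans (child _ here) p)) x) (j , z))))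
              (toℕ-fromℕ (s e))

    -- The same, with the common child expressed by equality of multiplicities.
    ascent-rightmost′ : IsTreeAscent τ (a , c) → Descendant τ c b → # τ c a ≡ # τ c b → ¬ LeftOf τ a b
    ascent-rightmost′ α (j , y) eq with IsTreeAscent.descendant α
    ... | i , x@(us , p , a∈) with toℕ-injective {i = i} {j} (trans (sym (#-InChild w x)) (trans eq (#-InChild w y)))
    ...   | refl = ascent-rightmost α p a∈ (InChild-same w y p)

    module _ (f : Full τ) where

      -- Planarity with room to spare: it still holds after adding one to # τ c a.
      ascent-planar : IsTreeAscent τ (a , c) → a <ᶠ b → b <ᶠ c → # τ b a ≡ s b ⊎ # τ c a < # τ c b
      ascent-planar {a} {c} {b} α a<b b<c with comparable w (f a) (f b) a<b
      ... | inj₁ x        = inj₁ (trans (#-InChild w (IsTreeAscent.rightBelow α b b<c a<b x)) (toℕ-fromℕ (s b)))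
      ... | inj₂ (inj₁ l) = inj₁ (#-rightOf w l)
      ... | inj₂ (inj₂ l) = inj₂ (≤∧≢⇒< (#-LeftOf-mono w (f c) (IsTreeAscent.a<c α) b<c l) ne)
        where
        ne : ¬ # τ c a ≡ # τ c b
        -- With equal multiplicities, b is in the child of c containing a, or right
        -- of c, or left of c and thus left of a; each is impossible.
        ne eq with comparable w (f b) (f c) b<c
        ... | inj₁ y        = ascent-rightmost′ α y eq l
        ... | inj₂ (inj₁ m) = <-irrefl (trans eq (#-rightOf w m)) (ascent-< α)
        ... | inj₂ (inj₂ m) = LeftOf-asym w l (LeftOf-descʳ w (IsTreeAscent.descendant α) m)

      -- Two ascents of c in the same child of c lie on its right spine, hence the
      -- smaller one is in the right child of the larger one, which is empty.
      ascents-apart : IsTreeAscent τ (a , c) → IsTreeAscent τ (d , c) → a <ᶠ d → 0 < s d → ¬ # τ c a ≡ # τ c d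
      ascents-apart {a} {c} {d} α δ a<d 0<sd eq with comparable w (f a) (f d) a<d
      ... | inj₂ (inj₂ l) = ascent-rightmost′ α (IsTreeAscent.descendant δ) eq l
      ... | inj₂ (inj₁ l) = ascent-rightmost′ δ (IsTreeAscent.descendant α) (sym eq) l
      ... | inj₁ x with IsTreeAscent.rightEmpty δ 0<sd
      ...   | us , p , empty with subst (a ∈ᵗ_) empty
                  (InChild-same w (IsTreeAscent.rightBelow α d (IsTreeAscent.a<c δ) a<d x) p)
      ...     | _ , ()

-- The tree with given tree-inversions

module _ {n : ℕ} where

  -- All labels, the largest first.
  descending : List (Fin n)
  descending = List.tabulate opposite

  ∈-descending : ∀ a → a ∈ descending
  ∈-descending a = subst (_∈ descending) (opposite-involutive a) (∈-tabulate⁺ {f = opposite} (opposite a))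

  descending-sorted : AllPairs (λ c a → a <ᶠ c) descending
  descending-sorted = AllPairs.tabulate⁺-< λ {i} {j} i<j →
    subst₂ _<_ (sym (opposite-prop j)) (sym (opposite-prop i)) (∸-monoʳ-< (s≤s i<j) (toℕ<n j))

module _ {n : ℕ} {s : WeakComposition n} (J : Multiset n) where

  private variable
    a c : Fin n
    ls : List (Fin n)

  -- The labels of X that J puts into the i-th child of c.
  AtChild : Pred (Fin n) 0ℓ → (c : Fin n) → Fin (suc (s c)) → Pred (Fin n) 0ℓ
  AtChild X c i a = X a × J c a ≡ toℕ i

  atChild? : ∀ {X} → Decidable X → ∀ c i → Decidable (AtChild X c i)
  atChild? X? c i a = X? a ×-dec (J c a ≟ⁿ toℕ i)

  -- The tree with tree-inversions J whose labels are the elements of X in the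
  -- given descending list: the first of them is the root.
  build : List (Fin n) → {X : Pred (Fin n) 0ℓ} → Decidable X → PlanarTree s
  build []       X? = leaf
  build (c ∷ ls) X? with X? c
  ... | yes _ = node c (Vec.tabulate λ i → build ls (atChild? X? c i))
  ... | no _  = build ls X?

  lookup-children : ∀ ls {X : Pred (Fin n) 0ℓ} (X? : Decidable X) c j →
    lookup (Vec.tabulate λ i → build ls (atChild? X? c i)) j ≡ build ls (atChild? X? c j)
  lookup-children ls X? c = lookup∘tabulate (λ i → build ls (atChild? X? c i))

  ∈-build⁻ : ∀ ls {X : Pred (Fin n) 0ℓ} (X? : Decidable X) → a ∈ᵗ build ls X? → a ∈ ls × X a
  ∈-child⁻ : ∀ ls {X : Pred (Fin n) 0ℓ} (X? : Decidable X) j →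
    a ∈ᵗ lookup (Vec.tabulate λ i → build ls (atChild? X? c i)) j →
    a ∈ᵗ build ls (atChild? X? c j) × a ∈ ls × X a × J c a ≡ toℕ j
  ∈-build⁻ {a} (c ∷ ls) X? a∈ with X? c
  ... | no _  = let a∈ls , Xa = ∈-build⁻ ls X? a∈ in there a∈ls , Xa
  ... | yes Xc with ∈-node⁻ a∈
  ...   | inj₁ refl    = here refl , Xc
  ...   | inj₂ (j , x) = let _ , a∈ls , Xa , _ = ∈-child⁻ ls X? j x in there a∈ls , Xa
  ∈-child⁻ {a} {c} ls X? j x = x′ , ∈-build⁻ ls (atChild? X? c j) x′
    where
    x′ : a ∈ᵗ build ls (atChild? X? c j)
    x′ = subst (a ∈ᵗ_) (lookup-children ls X? c j) x

  module _ (I : IsInversion {s = s} J) where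
    open IsInversion I

    ∈-build⁺ : AllPairs (λ c a → a <ᶠ c) ls → ∀ {X : Pred (Fin n) 0ℓ} (X? : Decidable X) →
      a ∈ ls → X a → a ∈ᵗ build ls X?
    ∈-build⁺ {ls = c ∷ _} (c> ∷ sorted) X? (here refl) Xa with X? c
    ... | yes _ = _ , here
    ... | no ¬Xc = contradiction Xa ¬Xc
    ∈-build⁺ {ls = c ∷ ls} {a} (c> ∷ sorted) X? (there a∈) Xa with X? c
    ... | no _  = ∈-build⁺ sorted X? a∈ Xa
    ... | yes _ = ∈-child here j (subst (a ∈ᵗ_) (sym (lookup-children ls X? c j))
        (∈-build⁺ sorted (atChild? X? c j) a∈ (Xa , sym (toℕ-fromℕ< J<))))
      where
      J< : J c a < suc (s c)
      J< = s≤s (bounded (All.lookup c> a∈))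
      j = fromℕ< J<

    build-Wf : AllPairs (λ c a → a <ᶠ c) ls → ∀ {X : Pred (Fin n) 0ℓ} (X? : Decidable X) → Wf (build ls X?)
    build-Wf {ls = []} _ X? = leaf
    build-Wf {ls = c ∷ ls} (c> ∷ sorted) X? with X? c
    ... | no _  = build-Wf sorted X?
    ... | yes _ = node
      (λ j → subst Wf (sym (lookup-children ls X? c j)) (build-Wf sorted (atChild? X? c j)))
      (λ {j} x → All.lookup c> (proj₁ (proj₂ (∈-child⁻ ls X? j x))))
      (λ {j} {k} x y → toℕ-injective (trans (sym (proj₂ (proj₂ (proj₂ (∈-child⁻ ls X? j x)))))
                                            (proj₂ (proj₂ (proj₂ (∈-child⁻ ls X? k y))))))

    -- For two labels c > a in different children of the root r, transitivity and
    -- planarity of J at r > c > a say that J c a is 0 if a is left of c, and s c if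
    -- a is right of c.
    #-build : AllPairs (λ c a → a <ᶠ c) ls → ∀ {X : Pred (Fin n) 0ℓ} (X? : Decidable X) →
      a ∈ᵗ build ls X? → c ∈ᵗ build ls X? → a <ᶠ c → # (build ls X?) c a ≡ J c a
    #-build {ls = []} _ X? (_ , ())
    #-build {ls = r ∷ ls} {a} {c} (r> ∷ sorted) X? a∈ c∈ a<c with X? r | build-Wf (r> ∷ sorted) X?
    ... | no _  | w = #-build sorted X? a∈ c∈ a<c
    ... | yes _ | w with ∈-node⁻ a∈ | ∈-node⁻ c∈
    ...   | inj₁ refl | inj₁ refl = contradiction a<c (<ᶠ-irrefl refl)
    ...   | inj₁ refl | inj₂ (k , y) = contradiction a<c (<ᶠ-asym (below {j = k} w here y))
    ...   | inj₂ (j , x) | inj₁ refl = trans (#-InChild {i = j} w (_ , here , x))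
              (sym (proj₂ (proj₂ (proj₂ (∈-child⁻ ls X? j x)))))
    ...   | inj₂ (j , x) | inj₂ (k , y) = inner
      where
      Ja : J r a ≡ toℕ j
      Ja = proj₂ (proj₂ (proj₂ (∈-child⁻ ls X? j x)))
      Jc : J r c ≡ toℕ k
      Jc = proj₂ (proj₂ (proj₂ (∈-child⁻ ls X? k y)))
      c<r : c <ᶠ r
      c<r = below {j = k} w here y
      inner : # (node r (Vec.tabulate λ i → build ls (atChild? X? r i))) c a ≡ J c a
      inner with <ᶠ-cmp j k
      ... | tri< j<k _ _ with transitive a<c c<r
      ...   | inj₁ eq = trans (#-leftOf w (r , j , k , j<k , _ , here , x , y)) (sym eq)
      ...   | inj₂ le = contradiction (<-≤-trans j<k (subst₂ _≤_ Jc Ja le)) (<-irrefl refl)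
      inner | tri> _ _ k<j with planar a<c c<r
      ...   | inj₁ eq = trans (#-rightOf w (r , k , j , k<j , _ , here , y , x)) (sym eq)
      ...   | inj₂ le = contradiction (<-≤-trans k<j (subst₂ _≤_ Ja Jc le)) (<-irrefl refl)
      inner | tri≈ _ refl _ = trans (#-⊑ w (child j here) x y a<c)
        (trans (cong (λ u → # u c a) (lookup-children ls X? r j))
          (#-build sorted (atChild? X? r j) (proj₁ (∈-child⁻ ls X? j x)) (proj₁ (∈-child⁻ ls X? j y)) a<c))

    -- Every multiset satisfying IsInversion is that of a tree.
    inversion-tree : ∃[ T ] (∀ {a c} → a <ᶠ c → # (tree {s = s} T) c a ≡ J c a)
    inversion-tree = Wf⇒DecreasingTree (build descending U?) (build-Wf descending-sorted U?) all∈
                   , #-build descending-sorted U? (all∈ _) (all∈ _)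
      where
      U? : Decidable {A = Fin n} (λ a → a ≡ a)
      U? _ = yes refl
      all∈ : Full (build descending U?)
      all∈ a = ∈-build⁺ descending-sorted U? (∈-descending a) refl

-- Transitive closure

module _ {n : ℕ} {I : Multiset n} where

  private variable
    a b c : Fin n

  path-< : TransitivityPath I c a → a <ᶠ c
  path-< (last a<c _)     = a<c
  path-< (step _ b<c _ p) = <ᶠ-trans (path-< p) b<c

  first-> : (p : TransitivityPath I c a) → 0 < first p
  first-> (last _ x)     = x
  first-> (step _ _ x _) = x

  _++ᵖ_ : TransitivityPath I c b → TransitivityPath I b a → TransitivityPath I c a
  last b<c x     ++ᵖ q = step _ b<c x q
  step d d<c x p ++ᵖ q = step d d<c x (p ++ᵖ q)

  first-++ᵖ : (p : TransitivityPath I c b) (q : TransitivityPath I b a) → first (p ++ᵖ q) ≡ first p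
  first-++ᵖ (last _ _)     q = refl
  first-++ᵖ (step _ _ _ _) q = refl

  -- The label b is the second vertex of a path from c to a.  The value of first at
  -- a path depends only on b, so that its maximum is taken over finitely many b.
  Second : Fin n → Fin n → Fin n → Set
  Second c a b = b <ᶠ c × 0 < I c b × (b ≡ a ⊎ TransitivityPath I b a)

  Second⇒path : Second c a b → ∃[ p ] first {I = I} {c} {a} p ≡ I c b
  Second⇒path (b<c , x , inj₁ refl) = last b<c x , refl
  Second⇒path (b<c , x , inj₂ p)    = step _ b<c x p , refl

  path⇒Second : (p : TransitivityPath I c a) → ∃[ b ] (Second c a b × first p ≡ I c b)
  path⇒Second (last a<c x)     = _ , (a<c , x , inj₁ refl) , refl
  path⇒Second (step b b<c x p) = b , (b<c , x , inj₂ p) , refl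

  path? : ∀ c a → Dec (TransitivityPath I c a)
  path? c a = go c (<-wellFounded c)
    where
    go : ∀ c → Acc _<ᶠ_ c → Dec (TransitivityPath I c a)
    second? : ∀ c → Acc _<ᶠ_ c → ∀ b → Dec (Second c a b)
    go c ac = map′ (λ (b , x) → proj₁ (Second⇒path x))
                   (λ p → let b , x , _ = path⇒Second p in b , x)
                   (any? (second? c ac))
    second? c (acc rs) b with b <ᶠ? c
    ... | no b≮c  = no (b≮c ∘ proj₁)
    ... | yes b<c = map′ (b<c ,_) proj₂ ((0 <ⁿ? I c b) ×-dec ((b ≟ᶠ a) ⊎-dec go b (rs b<c)))

  Second? : ∀ c a b → Dec (Second c a b)
  Second? c a b = (b <ᶠ? c) ×-dec (0 <ⁿ? I c b) ×-dec ((b ≟ᶠ a) ⊎-dec path? b a)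

-- The maximum of f over a decidable subset of a finite set, if it is nonempty.
argmax : ∀ {m} {P : Pred (Fin m) 0ℓ} → Decidable P → (f : Fin m → ℕ) →
  (∀ i → ¬ P i) ⊎ ∃[ i ] (P i × ∀ j → P j → f j ≤ f i)
argmax {zero} P? f = inj₁ λ ()
argmax {suc m} P? f with P? zero | argmax (P? ∘ suc) (f ∘ suc)
... | no ¬p | inj₁ none = inj₁ λ { zero → ¬p ; (suc i) → none i }
... | no ¬p | inj₂ (i , p , max) = inj₂ (suc i , p , λ { zero q → contradiction q ¬p ; (suc j) q → max j q })
... | yes p | inj₁ none = inj₂ (zero , p , λ { zero _ → ≤-refl ; (suc j) q → contradiction q (none j) })
... | yes p | inj₂ (i , p′ , max) with ≤-total (f zero) (f (suc i))
...   | inj₁ le = inj₂ (suc i , p′ , λ { zero _ → le ; (suc j) q → max j q })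
...   | inj₂ ge = inj₂ (zero , p , λ { zero _ → ≤-refl ; (suc j) q → ≤-trans (max j q) ge })

module _ {n : ℕ} (I : Multiset n) where

  -- The transitive closure: a multiplicity for every pair, with the proof that it
  -- is the right one.
  closure : ∀ c a → ∃ (IsClosureMultiplicity I c a)
  closure c a with argmax (Second? {I = I} c a) (I c)
  ... | inj₁ none = 0 , inj₁ ((λ p → let b , x , _ = path⇒Second p in none b x) , refl)
  ... | inj₂ (b , x , max) = I c b , inj₂ (proj₁ (Second⇒path x) , proj₂ (Second⇒path x) ,
    λ q → let d , y , eq = path⇒Second q in subst (_≤ I c b) (sym eq) (max d y))

module _ {n : ℕ} {I : Multiset n} {c a : Fin n} where

  closure-unique : ∀ {m m′} → IsClosureMultiplicity I c a m → IsClosureMultiplicity I c a m′ → m ≡ m′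
  closure-unique (inj₁ (_ , refl)) (inj₁ (_ , refl)) = refl
  closure-unique (inj₁ (¬p , _)) (inj₂ (p , _)) = contradiction p ¬p
  closure-unique (inj₂ (p , _)) (inj₁ (¬p , _)) = contradiction p ¬p
  closure-unique (inj₂ (p , refl , max)) (inj₂ (q , refl , max′)) = ≤-antisym (max′ p) (max q)

  path⇒closure : ∀ {m} → IsClosureMultiplicity I c a m → (p : TransitivityPath I c a) → first p ≤ m
  path⇒closure (inj₁ (¬p , _))      p = contradiction p ¬p
  path⇒closure (inj₂ (_ , _ , max)) p = max p

  ≤closure : ∀ {m} → IsClosureMultiplicity I c a m → a <ᶠ c → I c a ≤ m
  ≤closure cl a<c with 0 <ⁿ? I c a
  ... | yes x = path⇒closure cl (last a<c x)
  ... | no ¬x = ≤-trans (≮⇒≥ ¬x) z≤n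

module _ {n : ℕ} {s : WeakComposition n} {I : Multiset n}
  (bounded : ∀ {a c} → a <ᶠ c → I c a ≤ s c)
  (planar  : ∀ {a b c} → a <ᶠ b → b <ᶠ c → I b a ≡ s b ⊎ I c a ≤ I c b) where

  private variable
    a b c : Fin n

  first-bounded : (p : TransitivityPath I c a) → first p ≤ s c
  first-bounded (last a<c _)     = bounded a<c
  first-bounded (step _ b<c _ _) = bounded b<c

  -- If a < b < c, a path from c to a either passes through b or has a step x > y
  -- jumping over b.  In the second case planarity at x > b > y either lets the step
  -- end at b instead, or gives I b y the maximal value s b.  Then, unless s b is 0,
  -- the rest of the path, entered from b, is a path from b to a starting with
  -- multiplicity s b.
  cross : (p : TransitivityPath I c a) → a <ᶠ b → b <ᶠ c →
    (∃[ q ] first p ≤ first {I = I} {c} {b} q) ⊎ (s b ≡ 0 ⊎ ∃[ q ] first {I = I} {b} {a} q ≡ s b)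
  cross {b = b} (last a<c x) a<b b<c with planar a<b b<c
  ... | inj₂ le = inj₁ (last b<c (<-≤-trans x le) , le)
  ... | inj₁ eq with s b ≟ⁿ 0
  ...   | yes s0 = inj₂ (inj₁ s0)
  ...   | no s≢0 = inj₂ (inj₂ (last a<b (subst (0 <_) (sym eq) (n≢0⇒n>0 s≢0)) , eq))
  cross {b = b} (step d d<c x p) a<b b<c with <ᶠ-cmp d b
  ... | tri≈ _ refl _ = inj₁ (last d<c x , ≤-refl)
  ... | tri> _ _ b<d with cross p a<b b<d
  ...   | inj₁ (q , _) = inj₁ (step d d<c x q , ≤-refl)
  ...   | inj₂ y       = inj₂ y
  cross {b = b} (step d d<c x p) a<b b<c | tri< d<b _ _ with planar d<b b<c
  ... | inj₂ le = inj₁ (last b<c (<-≤-trans x le) , le)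
  ... | inj₁ eq with s b ≟ⁿ 0
  ...   | yes s0 = inj₂ (inj₁ s0)
  ...   | no s≢0 = inj₂ (inj₂ (step d d<b (subst (0 <_) (sym eq) (n≢0⇒n>0 s≢0)) p , eq))

  -- The closure of a bounded planar multiset is bounded, transitive and planar.
  closure-isInversion : IsInversion {s = s} (λ c a → proj₁ (closure I c a))
  closure-isInversion = record
    { bounded    = λ {a} {c} _ → bnd c a (proj₂ (closure I c a))
    ; transitive = λ {a} {b} {c} a<b b<c → trn (proj₂ (closure I b a)) (proj₂ (closure I c b)) (proj₂ (closure I c a))
    ; planar     = λ {a} {b} {c} a<b b<c → pln a<b b<c (proj₂ (closure I b a)) (proj₂ (closure I c b)) (proj₂ (closure I c a))
    }
    where
    bnd : ∀ c a {m} → IsClosureMultiplicity I c a m → m ≤ s c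
    bnd c a (inj₁ (_ , refl))     = z≤n
    bnd c a (inj₂ (p , refl , _)) = first-bounded p
    trn : ∀ {m₁ m₂ m₃} → IsClosureMultiplicity I b a m₁ → IsClosureMultiplicity I c b m₂ →
      IsClosureMultiplicity I c a m₃ → m₁ ≡ 0 ⊎ m₂ ≤ m₃
    trn (inj₁ (_ , refl)) _ _ = inj₁ refl
    trn _ (inj₁ (_ , refl)) _ = inj₂ z≤n
    trn (inj₂ (q , _)) (inj₂ (p , refl , _)) C = inj₂ (subst (_≤ _) (first-++ᵖ p q) (path⇒closure C (p ++ᵖ q)))
    pln : ∀ {m₁ m₂ m₃} → a <ᶠ b → b <ᶠ c → IsClosureMultiplicity I b a m₁ → IsClosureMultiplicity I c b m₂ →
      IsClosureMultiplicity I c a m₃ → m₁ ≡ s b ⊎ m₃ ≤ m₂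
    pln _ _ _ _ (inj₁ (_ , refl)) = inj₂ z≤n
    pln a<b b<c C₁ C₂ (inj₂ (p , refl , _)) with cross p a<b b<c
    ... | inj₁ (q , le)        = inj₂ (≤-trans le (path⇒closure C₂ q))
    ... | inj₂ (inj₁ s0)       = inj₁ (≤-antisym (bnd _ _ C₁) (subst (_≤ _) (sym s0) z≤n))
    ... | inj₂ (inj₂ (q , eq)) = inj₁ (≤-antisym (bnd _ _ C₁) (subst (_≤ _) eq (path⇒closure C₁ q)))

-- Sums over finite setoids

module _ (S : Setoid 0ℓ 0ℓ) where
  open Setoid S using (Carrier; _≈_) renaming (refl to ≈-refl; sym to ≈-sym; trans to ≈-trans)
  open SetoidMembership S using () renaming (_∈_ to _∈ˢ_)

  module _ (f : Carrier → ℕ) (f-cong : ∀ {x y} → x ≈ y → f x ≡ f y) where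

    sum-─ : ∀ {x xs} (p : x ∈ˢ xs) → sum (map f xs) ≡ f x + sum (map f (xs ─ p))
    sum-─ {xs = _ ∷ xs} (here x≈y) = cong (_+ sum (map f xs)) (sym (f-cong x≈y))
    sum-─ {x} {y ∷ xs} (there p) = trans (cong (f y +_) (sum-─ p)) (x∙yz≈y∙xz +-commutativeSemigroup (f y) (f x) _)

    ∈-─ : ∀ {x z xs} (p : x ∈ˢ xs) → ¬ x ≈ z → z ∈ˢ xs → z ∈ˢ (xs ─ p)
    ∈-─ (here x≈y) x≉z (here z≈y) = contradiction (≈-trans x≈y (≈-sym z≈y)) x≉z
    ∈-─ (here _)   _   (there q)  = q
    ∈-─ (there _)  _   (here z≈y) = here z≈y
    ∈-─ (there p)  x≉z (there q)  = there (∈-─ p x≉z q)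

    -- A list without repetitions has at most the sum of any list containing it.
    sum-mono-⊆ : ∀ {xs ys} → UniqueSetoid.Unique S xs → (∀ {x} → x ∈ˢ xs → x ∈ˢ ys) →
      sum (map f xs) ≤ sum (map f ys)
    sum-mono-⊆ [] _ = z≤n
    sum-mono-⊆ {x ∷ xs} {ys} (x≉ ∷ u) sub = subst (sum (map f (x ∷ xs)) ≤_) (sym (sum-─ (sub (here ≈-refl))))
      (+-monoʳ-≤ (f x) (sum-mono-⊆ u λ z∈ → ∈-─ (sub (here ≈-refl)) (apart z∈) (sub (there z∈))))
      where
      apart : ∀ {z} → z ∈ˢ xs → ¬ x ≈ z
      apart z∈ x≈z = All.lookupWith (λ x≉y z≈y → x≉y (≈-trans x≈z z≈y)) x≉ z∈

    sum-unique : ∀ {xs ys} → UniqueSetoid.Unique S xs → UniqueSetoid.Unique S ys →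
      (∀ {x} → x ∈ˢ xs → x ∈ˢ ys) → (∀ {x} → x ∈ˢ ys → x ∈ˢ xs) → sum (map f xs) ≡ sum (map f ys)
    sum-unique u v p q = ≤-antisym (sum-mono-⊆ u p) (sum-mono-⊆ v q)

-- Coefficients of polynomials

coeff-+ₚ : ∀ p q k → coeff (p +ₚ q) k ≡ coeff p k + coeff q k
coeff-+ₚ []      q       k       = refl
coeff-+ₚ (a ∷ p) []      k       = sym (+-identityʳ _)
coeff-+ₚ (a ∷ p) (b ∷ q) zero    = refl
coeff-+ₚ (a ∷ p) (b ∷ q) (suc k) = coeff-+ₚ p q k

coeff-map-* : ∀ a p k → coeff (map (a *_) p) k ≡ a * coeff p k
coeff-map-* a []      k       = sym (*-zeroʳ a)
coeff-map-* a (b ∷ p) zero    = refl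
coeff-map-* a (b ∷ p) (suc k) = coeff-map-* a p k

coeff-sumₚ : ∀ {A : Set} (f : A → Poly) xs k → coeff (sumₚ (map f xs)) k ≡ sum (map (λ x → coeff (f x) k) xs)
coeff-sumₚ f []       k = refl
coeff-sumₚ f (x ∷ xs) k = trans (coeff-+ₚ (f x) _ k) (cong (coeff (f x) k +_) (coeff-sumₚ f xs k))

coeff-*ₚ-∷ : ∀ a p q k → coeff ((a ∷ p) *ₚ q) k ≡ a * coeff q k + coeff (0 ∷ (p *ₚ q)) k
coeff-*ₚ-∷ a p q k = trans (coeff-+ₚ (map (a *_) q) _ k) (cong (_+ _) (coeff-map-* a q k))

coeff-0∷-cong : ∀ {p q} → p ≈ₚ q → 0 ∷ p ≈ₚ 0 ∷ q
coeff-0∷-cong p≈q zero    = refl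
coeff-0∷-cong p≈q (suc k) = p≈q k

coeff-0∷[] : ∀ k → coeff (0 ∷ []) k ≡ 0
coeff-0∷[] zero    = refl
coeff-0∷[] (suc k) = refl

1∷[]-*ₚ : ∀ p → (1 ∷ []) *ₚ p ≈ₚ p
1∷[]-*ₚ p k = trans (coeff-*ₚ-∷ 1 [] p k)
  (trans (cong₂ _+_ (*-identityˡ (coeff p k)) (coeff-0∷[] k)) (+-identityʳ _))

t-*ₚ : ∀ p → t *ₚ p ≈ₚ 0 ∷ p
t-*ₚ p k = trans (coeff-*ₚ-∷ 0 (1 ∷ []) p k) (coeff-0∷-cong (1∷[]-*ₚ p) k)

1+t-*ₚ : ∀ p k → coeff ((1ₚ +ₚ t) *ₚ p) k ≡ coeff p k + coeff (0 ∷ p) k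
1+t-*ₚ p k = trans (coeff-*ₚ-∷ 1 (1 ∷ []) p k)
  (cong₂ _+_ (*-identityˡ (coeff p k)) (coeff-0∷-cong (1∷[]-*ₚ p) k))

-- The sum of a function respecting equality is the same for all enumerations.

module _ {S : Setoid 0ℓ 0ℓ} (f : Setoid.Carrier S → Poly)
         (f-cong : ∀ {x y} → Setoid._≈_ S x y → f x ≈ₚ f y) where

  sum-enumerations : (E E′ : Enumeration S) →
    sumₚ (map f (Enumeration.elements E)) ≈ₚ sumₚ (map f (Enumeration.elements E′))
  sum-enumerations E E′ k = trans (coeff-sumₚ f E.elements k) (trans
    (sum-unique S (λ x → coeff (f x) k) (λ x≈y → f-cong x≈y k) E.distinct E′.distinct
      (λ _ → E′.complete _) (λ _ → E.complete _))
    (sym (coeff-sumₚ f E′.elements k)))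
    where
    module E  = Enumeration E
    module E′ = Enumeration E′

-- Sublists and choices

module _ {A : Set} where

  Unique-⊆ : ∀ {xs ys : List A} → xs ⊆ ys → Unique ys → Unique xs
  Unique-⊆ []         []      = []
  Unique-⊆ (_ ∷ʳ p)   (_ ∷ u) = Unique-⊆ p u
  Unique-⊆ (refl ∷ p) (y ∷ u) = All-resp-⊆ p y ∷ Unique-⊆ p u

  filter-⊆ : ∀ {P : Pred A 0ℓ} (P? : Decidable P) xs → filter P? xs ⊆ xs
  filter-⊆ P? []       = []
  filter-⊆ P? (x ∷ xs) with P? x
  ... | yes _ = refl ∷ filter-⊆ P? xs
  ... | no _  = x ∷ʳ filter-⊆ P? xs

  -- A sublist of xs together with its embedding into xs.
  Sublist : List A → Set
  Sublist xs = ∃ (_⊆ xs)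

  -- The two ways to extend a sublist of xs to one of x ∷ xs.
  skip keep : ∀ x {xs} → Sublist xs → Sublist (x ∷ xs)
  skip x (ys , p) = ys , x ∷ʳ p
  keep x (ys , p) = x ∷ ys , refl ∷ p

  -- The subsets of the set of entries of xs, if xs has no repetitions.
  sublists : ∀ xs → List (Sublist xs)
  sublists []       = ([] , []) ∷ []
  sublists (x ∷ xs) = map (skip x) (sublists xs) ++ map (keep x) (sublists xs)

  ∈-sublists : ∀ {ys xs} (p : ys ⊆ xs) → (ys , p) ∈ sublists xs
  ∈-sublists []         = here refl
  ∈-sublists (x ∷ʳ p)   = ∈-++⁺ˡ (∈-map⁺ (skip x) (∈-sublists p))
  ∈-sublists {xs = x ∷ xs} (refl ∷ p) = ∈-++⁺ʳ (map (skip x) (sublists xs)) (∈-map⁺ (keep x) (∈-sublists p))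

  -- Equality of lists as sets.
  SameElements : List A → List A → Set
  SameElements ys zs = ∀ {x} → (x ∈ ys → x ∈ zs) × (x ∈ zs → x ∈ ys)

  sublists-distinct : ∀ {xs} → Unique xs → AllPairs (λ (ys , _) (zs , _) → ¬ SameElements ys zs) (sublists xs)
  sublists-distinct [] = [] ∷ []
  sublists-distinct {x ∷ xs} (x∉ ∷ u) = AllPairs.++⁺
    (AllPairs.map⁺ (sublists-distinct u))
    (AllPairs.map⁺ (AllPairs.map (λ {P} {Q} → keep-distinct P Q) (sublists-distinct u)))
    (All.map⁺ (All.universal (λ P → All.map⁺ (All.universal (skip≢keep P) _)) _))
    where
    x∉⊆ : (P : Sublist xs) → ¬ x ∈ proj₁ P
    x∉⊆ (ys , p) x∈ = All.lookup x∉ (Sublist.lookup p x∈) refl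
    skip≢keep : (P Q : Sublist xs) → ¬ SameElements (proj₁ P) (x ∷ proj₁ Q)
    skip≢keep P Q same = x∉⊆ P (proj₂ same (here refl))
    tail : ∀ {y ys zs} → ¬ x ∈ ys → y ∈ ys → y ∈ x ∷ zs → y ∈ zs
    tail x∉ys y∈ (here refl) = contradiction y∈ x∉ys
    tail _    _  (there y∈)  = y∈
    keep-distinct : (P Q : Sublist xs) → ¬ SameElements (proj₁ P) (proj₁ Q) →
      ¬ SameElements (x ∷ proj₁ P) (x ∷ proj₁ Q)
    keep-distinct P Q ne same = ne ((λ y∈ → tail (x∉⊆ P) y∈ (proj₁ same (there y∈)))
                                  , (λ y∈ → tail (x∉⊆ Q) y∈ (proj₂ same (there y∈))))

  -- The sum of t^|A| over all subsets A of an m-element set is (1 + t)^m.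
  binomial : ∀ xs → sumₚ (map (λ (P : Sublist xs) → t ^ₚ length (proj₁ P)) (sublists xs)) ≈ₚ (1ₚ +ₚ t) ^ₚ length xs
  binomial []       k = trans (coeff-+ₚ 1ₚ [] k) (+-identityʳ _)
  binomial (x ∷ xs) k = begin
    coeff (sumₚ (map f′ (map (skip x) Ps ++ map (keep x) Ps))) k
      ≡⟨ coeff-sumₚ f′ (map (skip x) Ps ++ map (keep x) Ps) k ⟩
    sum (map g (map (skip x) Ps ++ map (keep x) Ps))
      ≡⟨ cong sum (map-++ g (map (skip x) Ps) _) ⟩
    sum (map g (map (skip x) Ps) ++ map g (map (keep x) Ps))
      ≡⟨ sum-++ (map g (map (skip x) Ps)) _ ⟩
    sum (map g (map (skip x) Ps)) + sum (map g (map (keep x) Ps))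
      ≡⟨ cong₂ (λ xs ys → sum xs + sum ys) (map-∘ Ps) (map-∘ Ps) ⟨
    sum (map (λ P → coeff (f P) k) Ps) + sum (map (λ P → coeff (t *ₚ f P) k) Ps)
      ≡⟨ cong₂ _+_ (sym (coeff-sumₚ f Ps k)) (cong sum (map-cong (λ P → t-*ₚ (f P) k) Ps)) ⟩
    coeff (sumₚ (map f Ps)) k + sum (map (λ P → coeff (0 ∷ f P) k) Ps)
      ≡⟨ cong (coeff (sumₚ (map f Ps)) k +_) (shift k) ⟩
    coeff (sumₚ (map f Ps)) k + coeff (0 ∷ sumₚ (map f Ps)) k
      ≡⟨ cong₂ _+_ (binomial xs k) (coeff-0∷-cong (binomial xs) k) ⟩
    coeff ((1ₚ +ₚ t) ^ₚ length xs) k + coeff (0 ∷ (1ₚ +ₚ t) ^ₚ length xs) k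
      ≡⟨ 1+t-*ₚ ((1ₚ +ₚ t) ^ₚ length xs) k ⟨
    coeff ((1ₚ +ₚ t) ^ₚ length (x ∷ xs)) k ∎
    where
    open ≡-Reasoning
    Ps = sublists xs
    f : Sublist xs → Poly
    f P = t ^ₚ length (proj₁ P)
    f′ : Sublist (x ∷ xs) → Poly
    f′ P = t ^ₚ length (proj₁ P)
    g : Sublist (x ∷ xs) → ℕ
    g P = coeff (f′ P) k
    shift : ∀ k → sum (map (λ P → coeff (0 ∷ f P) k) Ps) ≡ coeff (0 ∷ sumₚ (map f Ps)) k
    shift zero    = zeros Ps
      where
      zeros : ∀ (Ps : List (Sublist xs)) → sum (map (λ _ → 0) Ps) ≡ 0
      zeros []       = refl
      zeros (_ ∷ Ps) = zeros Ps
    shift (suc k) = sym (coeff-sumₚ f Ps k)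

sumₚ-concatMap : ∀ {A B : Set} (f : B → Poly) (g : A → List B) (h : A → Poly) →
  (∀ x → sumₚ (map f (g x)) ≈ₚ h x) → ∀ xs → sumₚ (map f (concatMap g xs)) ≈ₚ sumₚ (map h xs)
sumₚ-concatMap f g h eq []       k = refl
sumₚ-concatMap f g h eq (x ∷ xs) k = begin
  coeff (sumₚ (map f (g x ++ concatMap g xs))) k
    ≡⟨ coeff-sumₚ f (g x ++ concatMap g xs) k ⟩
  sum (map f′ (g x ++ concatMap g xs))
    ≡⟨ cong sum (map-++ f′ (g x) _) ⟩
  sum (map f′ (g x) ++ map f′ (concatMap g xs))
    ≡⟨ sum-++ (map f′ (g x)) _ ⟩
  sum (map f′ (g x)) + sum (map f′ (concatMap g xs))
    ≡⟨ cong₂ _+_ (coeff-sumₚ f (g x) k) (coeff-sumₚ f (concatMap g xs) k) ⟨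
  coeff (sumₚ (map f (g x))) k + coeff (sumₚ (map f (concatMap g xs))) k
    ≡⟨ cong₂ _+_ (eq x k) (sumₚ-concatMap f g h eq xs k) ⟩
  coeff (h x) k + coeff (sumₚ (map h xs)) k
    ≡⟨ coeff-+ₚ (h x) _ k ⟨
  coeff (sumₚ (map h (x ∷ xs))) k ∎
  where
  open ≡-Reasoning
  f′ = λ y → coeff (f y) k

-- All vectors whose i-th entry is chosen from the list f i.
choices : ∀ {A : Set} {m} → (Fin m → List A) → List (Vec A m)
choices {m = zero}  f = [] ∷ []
choices {m = suc m} f = cartesianProductWith _∷_ (f zero) (choices (f ∘ suc))

∈-choices : ∀ {A : Set} {m} {f : Fin m → List A} (v : Vec A m) → (∀ i → Vec.lookup v i ∈ f i) → v ∈ choices f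
∈-choices []      _ = here refl
∈-choices (x ∷ v) h = ∈-cartesianProductWith⁺ _∷_ (h zero) (∈-choices v (h ∘ suc))

-- The sum of a tree and a set of ascents

module _ {n : ℕ} where

  open DecMembership (≡-dec (_≟ᶠ_ {n}) (_≟ᶠ_ {n})) using (_∈?_)

  private variable
    a b c d : Fin n

  module _ (I : Multiset n) (A : List (Fin n × Fin n)) where

    increase-∈ : (a , c) ∈ A → increase I A c a ≡ suc (I c a)
    increase-∈ {a} {c} ac∈ with (a , c) ∈? A
    ... | yes _   = +-comm _ 1
    ... | no ac∉  = contradiction ac∈ ac∉

    increase-∉ : ¬ (a , c) ∈ A → increase I A c a ≡ I c a
    increase-∉ {a} {c} ac∉ with (a , c) ∈? A
    ... | yes ac∈ = contradiction ac∈ ac∉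
    ... | no _    = +-identityʳ _

    ≤increase : I c a ≤ increase I A c a
    ≤increase = m≤m+n _ _

  module _ {I J : Multiset n} (I≗J : ∀ c a → I c a ≡ J c a) where

    path-resp : (p : TransitivityPath I c a) → ∃[ q ] first {I = J} {c} {a} q ≡ first p
    path-resp (last a<c x) = last a<c (subst (0 <_) (I≗J _ _) x) , sym (I≗J _ _)
    path-resp (step b b<c x p) = step b b<c (subst (0 <_) (I≗J _ _) x) (proj₁ (path-resp p)) , sym (I≗J _ _)

  closure-resp : ∀ {I J : Multiset n} → (∀ c a → I c a ≡ J c a) → ∀ {m} →
    IsClosureMultiplicity I c a m → IsClosureMultiplicity J c a m
  closure-resp I≗J (inj₁ (¬p , eq)) = inj₁ ((λ q → ¬p (proj₁ (path-resp (λ c a → sym (I≗J c a)) q))) , eq)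
  closure-resp I≗J (inj₂ (p , eq , max)) = inj₂ (proj₁ (path-resp I≗J p) , trans (proj₂ (path-resp I≗J p)) eq ,
    λ q → let p′ , eq′ = path-resp (λ c a → sym (I≗J c a)) q in subst (_≤ _) eq′ (max p′))

  module _ {s : WeakComposition n} (T : DecreasingTree s) {A : List (Fin n × Fin n)}
           (ascents : All (IsTreeAscent (tree T)) A) where

    private
      I′ : Multiset n
      I′ = increase (# (tree T)) A
      inv : IsInversion {s = s} (# (tree T))
      inv = #-isInversion (wf T) (full T)
      ascent : (a , c) ∈ A → IsTreeAscent (tree T) (a , c)
      ascent = All.lookup ascents

    -- An ascent a of c is not in the right child of c, so its multiplicity can
    -- grow by one.
    increase-bounded : a <ᶠ c → I′ c a ≤ s c
    increase-bounded {a} {c} a<c with (a , c) ∈? A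
    ... | yes ac∈ = subst (_≤ s c) (+-comm 1 _) (ascent-< (wf T) (ascent ac∈))
    ... | no _    = subst (_≤ s c) (sym (+-identityʳ _)) (IsInversion.bounded inv a<c)

    increase-planar : a <ᶠ b → b <ᶠ c → I′ b a ≡ s b ⊎ I′ c a ≤ I′ c b
    increase-planar {a} {b} {c} a<b b<c = by-cases ((a , c) ∈? A)
      where
      full-b : # (tree T) b a ≡ s b → I′ b a ≡ s b
      full-b eq = ≤-antisym (increase-bounded a<b) (subst (_≤ I′ b a) eq (≤increase (# (tree T)) A))
      by-cases : Dec ((a , c) ∈ A) → I′ b a ≡ s b ⊎ I′ c a ≤ I′ c b
      by-cases (yes ac∈) with ascent-planar (wf T) (full T) (ascent ac∈) a<b b<c
      ... | inj₁ eq = inj₁ (full-b eq)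
      ... | inj₂ lt = inj₂ (≤-trans (≤-reflexive (increase-∈ (# (tree T)) A ac∈)) (≤-trans lt (≤increase (# (tree T)) A)))
      by-cases (no ac∉) with IsInversion.planar inv a<b b<c
      ... | inj₁ eq = inj₁ (full-b eq)
      ... | inj₂ le = inj₂ (≤-trans (≤-reflexive (increase-∉ (# (tree T)) A ac∉)) (≤-trans le (≤increase (# (tree T)) A)))

    -- The tree T + A.
    sum-exists : ∃ (IsSum T A)
    sum-exists = R , λ {a} {c} a<c → subst (IsClosureMultiplicity I′ c a) (sym (#R a<c)) (proj₂ (closure I′ c a))
      where
      J : Multiset n
      J c a = proj₁ (closure I′ c a)
      R,#R : ∃[ R ] (∀ {a c} → a <ᶠ c → # (tree {s = s} R) c a ≡ J c a)
      R,#R = inversion-tree J (closure-isInversion increase-bounded increase-planar)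
      R = proj₁ R,#R
      #R = proj₂ R,#R

    -- Along a path below c, the multiplicity below c can only grow: a step b > y
    -- either is a tree-inversion of T, or y is a descendant of b.
    along-path : (p : TransitivityPath I′ d a) → d <ᶠ c → # (tree T) c d ≤ # (tree T) c a
    along-path {d} {a} {c} (last a<d x) d<c with (a , d) ∈? A
    ... | yes ad∈ = ≤-reflexive (sym (#-desc (wf T) (IsTreeAscent.descendant (ascent ad∈)) (full T d) (full T c) d<c))
    ... | no _ with IsInversion.transitive inv a<d d<c
    ...   | inj₁ eq = contradiction (sym (trans (+-identityʳ _) eq)) λ eq′ → <-irrefl eq′ x
    ...   | inj₂ le = le
    along-path (step b b<d x p) d<c = ≤-trans (along-path (last b<d x) d<c) (along-path p (<ᶠ-trans b<d d<c))

    -- An ascent outside A keeps its multiplicity in T + A.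
    no-gain : IsTreeAscent (tree T) (a , c) → ¬ (a , c) ∈ A → (p : TransitivityPath I′ c a) → first p ≤ # (tree T) c a
    no-gain α ac∉ (last _ _) = ≤-reflexive (increase-∉ (# (tree T)) A ac∉)
    no-gain {a} {c} α ac∉ (step d d<c _ p) = by-cases ((d , c) ∈? A)
      where
      by-cases : Dec ((d , c) ∈ A) → I′ c d ≤ # (tree T) c a
      by-cases (no dc∉)  = ≤-trans (≤-reflexive (increase-∉ (# (tree T)) A dc∉)) (along-path p d<c)
      by-cases (yes dc∈) = ≤-trans (≤-reflexive (increase-∈ (# (tree T)) A dc∈)) (≤∧≢⇒< (along-path p d<c)
        -- If both multiplicities agree then d and a lie in the same child of c.
        -- The path leaves d with a positive multiplicity, so s d > 0.
        λ eq → ascents-apart (wf T) (full T) α (ascent dc∈) (path-< p)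
          (<-≤-trans (first-> p) (first-bounded increase-bounded increase-planar p)) (sym eq))

    ≼-sum : ∀ R → IsSum T A R → T ≼ R
    ≼-sum R sum a<c = ≤-trans (≤increase (# (tree T)) A) (≤closure (sum a<c) a<c)

    ∈⇒increased : ∀ R → IsSum T A R → (a , c) ∈ A → # (tree T) c a < # (tree R) c a
    ∈⇒increased R sum ac∈ = ≤-trans (≤-reflexive (sym (increase-∈ (# (tree T)) A ac∈))) (≤closure (sum a<c) a<c)
      where a<c = IsTreeAscent.a<c (ascent ac∈)

    increased⇒∈ : ∀ R → IsSum T A R → IsTreeAscent (tree T) (a , c) → # (tree T) c a < # (tree R) c a → (a , c) ∈ A
    increased⇒∈ {a} {c} R sum α lt with (a , c) ∈? A
    ... | yes ac∈ = ac∈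
    ... | no ac∉ with # (tree R) c a | sum (IsTreeAscent.a<c α)
    ...   | _ | inj₁ (_ , refl)     = contradiction lt λ ()
    ...   | _ | inj₂ (p , refl , _) = contradiction (≤-<-trans (no-gain α ac∉ p) lt) (<-irrefl refl)

-- Equality of faces

module _ {n : ℕ} {s : WeakComposition n} where

  ≼-antisym : {T U : DecreasingTree s} → T ≼ U → U ≼ T → tree T ≡ tree U
  ≼-antisym {T} {U} T≼U U≼T = #-determines T U λ a<c → ≤-antisym (T≼U a<c) (U≼T a<c)

  -- Equality of faces, that is of the sets of trees in them.
  _≈ᶠ_ : PureInterval s → PureInterval s → Set
  P ≈ᶠ Q = Setoid._≈_ (Perm s) P Q

  module _ (P : PureInterval s) where
    open PureInterval P hiding (interval; dim)

    bottom≼top : bottom ≼ top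
    bottom≼top = ≼-sum bottom A-ascent top top-sum

    bottom∈ : interval P bottom
    bottom∈ = (λ _ → ≤-refl) , λ {a} {c} → bottom≼top {a} {c}

    top∈ : interval P top
    top∈ = (λ {a} {c} → bottom≼top {a} {c}) , λ _ → ≤-refl

  module _ {P Q : PureInterval s} where
    private
      module P = PureInterval P
      module Q = PureInterval Q

    -- Bottom and top are the least and the greatest element of the interval.
    bottom-cong : P ≈ᶠ Q → tree P.bottom ≡ tree Q.bottom
    bottom-cong (P⊆Q , Q⊆P) = ≼-antisym {P.bottom} {Q.bottom}
      (proj₁ (Q⊆P {Q.bottom} (bottom∈ Q))) (proj₁ (P⊆Q {P.bottom} (bottom∈ P)))

    top-cong : P ≈ᶠ Q → tree P.top ≡ tree Q.top
    top-cong (P⊆Q , Q⊆P) = ≼-antisym {P.top} {Q.top}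
      (proj₂ (P⊆Q {P.top} (top∈ P))) (proj₂ (Q⊆P {Q.top} (top∈ Q)))

  A-cong-⊆ : {P Q : PureInterval s} → P ≈ᶠ Q → ∀ {x} → x ∈ PureInterval.A P → x ∈ PureInterval.A Q
  A-cong-⊆ {P} {Q} P≈Q {a , c} x∈ = increased⇒∈ Q.bottom Q.A-ascent Q.top Q.top-sum
    (subst (λ τ → IsTreeAscent τ (a , c)) eq (All.lookup P.A-ascent x∈))
    (subst₂ (λ τ υ → # τ c a < # υ c a) eq (top-cong {P} {Q} P≈Q) (∈⇒increased P.bottom P.A-ascent P.top P.top-sum x∈))
    where
    module P = PureInterval P
    module Q = PureInterval Q
    eq = bottom-cong {P} {Q} P≈Q

  -- The set A is determined by the interval.
  A-cong : {P Q : PureInterval s} → P ≈ᶠ Q → SameElements (PureInterval.A P) (PureInterval.A Q)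
  A-cong {P} {Q} P≈Q = A-cong-⊆ {P} {Q} P≈Q , A-cong-⊆ {Q} {P} (Setoid.sym (Perm s) {P} {Q} P≈Q)

  dim-cong : {P Q : PureInterval s} → P ≈ᶠ Q → dim P ≡ dim Q
  -- A length is a sum of ones.
  dim-cong {P} {Q} P≈Q = trans (sym (sum-1 P.A)) (trans
    (sum-unique (setoid _) (λ _ → 1) (λ _ → refl) P.A-unique Q.A-unique
      (proj₁ (A-cong {P} {Q} P≈Q)) (proj₂ (A-cong {P} {Q} P≈Q)))
    (sum-1 Q.A))
    where
    module P = PureInterval P
    module Q = PureInterval Q
    sum-1 : (xs : List (Fin n × Fin n)) → sum (map (λ _ → 1) xs) ≡ length xs
    sum-1 []       = refl
    sum-1 (_ ∷ xs) = cong suc (sum-1 xs)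

  open DecMembership (≡-dec (_≟ᶠ_ {n}) (_≟ᶠ_ {n})) using (_∈?_)

  increase-cong : ∀ {I : Multiset n} {A B} → SameElements A B → ∀ c a → increase I A c a ≡ increase I B c a
  increase-cong {I} {A} {B} same c a with (a , c) ∈? A | (a , c) ∈? B
  ... | yes _ | yes _ = refl
  ... | no _  | no _  = refl
  ... | yes x | no ¬x = contradiction (proj₁ same x) ¬x
  ... | no ¬x | yes x = contradiction (proj₂ same x) ¬x

  interval-cong : (P Q : PureInterval s) → tree (PureInterval.bottom P) ≡ tree (PureInterval.bottom Q) →
    SameElements (PureInterval.A P) (PureInterval.A Q) → P ≈ᶠ Q
  interval-cong P Q eq same =
      (λ {R} (l , r) → (λ {a} {c} a<c → subst (λ τ → # τ c a ≤ # (tree R) c a) eq (l a<c))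
                     , (λ {a} {c} a<c → subst (# (tree R) c a ≤_) (tops a<c) (r a<c)))
    , (λ {R} (l , r) → (λ {a} {c} a<c → subst (λ τ → # τ c a ≤ # (tree R) c a) (sym eq) (l a<c))
                     , (λ {a} {c} a<c → subst (# (tree R) c a ≤_) (sym (tops a<c)) (r a<c)))
    where
    module P = PureInterval P
    module Q = PureInterval Q
    tops : ∀ {a c} → a <ᶠ c → # (tree P.top) c a ≡ # (tree Q.top) c a
    tops a<c = closure-unique
      (closure-resp (λ c a → trans (cong (λ τ → increase (# τ) P.A c a) eq) (increase-cong {# (tree Q.bottom)} same c a))
        (P.top-sum a<c))
      (Q.top-sum a<c)

  -- Enumeration of trees

  -- IsInversion is decidable, since it speaks about finitely many labels.
  isInversion? : (J : Multiset n) → Dec (IsInversion {s = s} J)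
  isInversion? J = map′
    (λ (x , y , z) → record { bounded = λ {a} {c} → x a c ; transitive = λ {a} {b} {c} → y a b c ; planar = λ {a} {b} {c} → z a b c })
    (λ i → let open IsInversion i in (λ _ _ → bounded) , (λ _ _ _ → transitive) , (λ _ _ _ → planar))
    ((all? λ a → all? λ c → (a <ᶠ? c) →-dec (J c a ≤? s c))
      ×-dec (all? λ a → all? λ b → all? λ c → (a <ᶠ? b) →-dec (b <ᶠ? c) →-dec ((J b a ≟ⁿ 0) ⊎-dec (J c b ≤? J c a)))
      ×-dec (all? λ a → all? λ b → all? λ c → (a <ᶠ? b) →-dec (b <ᶠ? c) →-dec ((J b a ≟ⁿ s b) ⊎-dec (J c a ≤? J c b))))

  -- Tables of multiplicities, the rows being indexed by c and the columns by a.
  Table : Set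
  Table = Vec (Vec ℕ n) n

  entry : Table → Multiset n
  entry v c a = Vec.lookup (Vec.lookup v c) a

  -- All tables with entries bounded by s.  They have an entry for every pair
  -- (c , a), including the irrelevant ones with a not smaller than c; hence
  -- different tables may lead to the same tree.
  tables : List Table
  tables = choices λ c → choices λ _ → upTo (suc (s c))

  -- The tree with the given table of multiplicities, if there is one.
  treesOf : Table → List (DecreasingTree s)
  treesOf v with isInversion? (entry v)
  ... | yes i = proj₁ (inversion-tree (entry v) i) ∷ []
  ... | no _  = []

  _≟ᵗ_ : (T U : DecreasingTree s) → Dec (tree T ≡ tree U)
  T ≟ᵗ U = map′ (λ h → #-determines T U λ {a} {c} → h a c) (λ eq a c _ → cong (λ τ → # τ c a) eq)
    (all? λ a → all? λ c → (a <ᶠ? c) →-dec (# (tree T) c a ≟ⁿ # (tree U) c a))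

  treeList : List (DecreasingTree s)
  treeList = deduplicate _≟ᵗ_ (concatMap treesOf tables)

  open SetoidMembership (Trees s) using () renaming (_∈_ to _∈ᵀ_)

  tableOf : DecreasingTree s → Table
  tableOf T = Vec.tabulate λ c → Vec.tabulate λ a → # (tree T) c a

  entry-tableOf : ∀ T c a → entry (tableOf T) c a ≡ # (tree T) c a
  entry-tableOf T c a = trans (cong (λ v → Vec.lookup v a) (lookup∘tabulate _ c)) (lookup∘tabulate _ a)

  tableOf∈ : ∀ T → tableOf T ∈ tables
  tableOf∈ T = ∈-choices _ λ c → ∈-choices _ λ a →
    ∈-upTo⁺ (s≤s (subst (_≤ s c) (sym (entry-tableOf T c a)) (#-bounded (tree T) c a)))

  ∈-treesOf : ∀ T → T ∈ᵀ treesOf (tableOf T)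
  ∈-treesOf T with isInversion? (entry (tableOf T))
  ... | yes i = here (#-determines T (proj₁ R) λ {a} {c} a<c → sym (trans (proj₂ R a<c) (entry-tableOf T c a)))
    where R = inversion-tree (entry (tableOf T)) i
  ... | no ¬i = contradiction i ¬i
    where
    inv = #-isInversion (wf T) (full T)
    open IsInversion inv
    E : ∀ c a → # (tree T) c a ≡ entry (tableOf T) c a
    E c a = sym (entry-tableOf T c a)
    i : IsInversion (entry (tableOf T))
    i = record
      { bounded    = λ {a} {c} a<c → subst (_≤ s c) (E c a) (bounded a<c)
      ; transitive = λ {a} {b} {c} a<b b<c → subst₂ _⊎_ (cong (_≡ 0) (E b a)) (cong₂ _≤_ (E c b) (E c a)) (transitive a<b b<c)
      ; planar     = λ {a} {b} {c} a<b b<c → subst₂ _⊎_ (cong (_≡ s b) (E b a)) (cong₂ _≤_ (E c a) (E c b)) (planar a<b b<c)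
      }

  treesDec : DecSetoid 0ℓ 0ℓ
  treesDec = record
    { Carrier = DecreasingTree s
    ; _≈_ = Setoid._≈_ (Trees s)
    ; isDecEquivalence = record { isEquivalence = Setoid.isEquivalence (Trees s) ; _≟_ = _≟ᵗ_ } }

  treeEnumeration : Enumeration (Trees s)
  treeEnumeration = record
    { elements = treeList
    ; complete = λ T → SetoidMembershipₚ.∈-deduplicate⁺ (Trees s) _≟ᵗ_ (λ {T} {U} {V} → respects T U V)
        {xs = concatMap treesOf tables} {z = T}
        (Any.concatMap⁺ treesOf (lose {P = λ v → T ∈ᵀ treesOf v} (tableOf∈ T) (∈-treesOf T)))
    ; distinct = UniqueDecSetoid.deduplicate-! treesDec (concatMap treesOf tables)
    }
    where
    respects : ∀ (T U V : DecreasingTree s) → tree V ≡ tree U → tree T ≡ tree U → tree T ≡ tree V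
    respects _ _ _ p q = trans q (sym p)

  -- Enumeration of faces

  -- The list of ascents counted by asc.
  ascentList : PlanarTree s → List (Fin n × Fin n)
  ascentList τ = filter (isTreeAscent? τ) (cartesianProduct (allFin n) (allFin n))

  ascentList-unique : ∀ τ → Unique (ascentList τ)
  ascentList-unique τ = Unique.filter⁺ (isTreeAscent? τ) (Unique.cartesianProduct⁺ (Unique.allFin⁺ n) (Unique.allFin⁺ n))

  ascentList-all : ∀ τ → All (IsTreeAscent τ) (ascentList τ)
  ascentList-all τ = All.all-filter (isTreeAscent? τ) (cartesianProduct (allFin n) (allFin n))

  -- The face [T , T + A].
  face : (T : DecreasingTree s) → Sublist (ascentList (tree T)) → PureInterval s
  face T (A , A⊆) = record
    { bottom   = T
    ; A        = A
    ; A-unique = Unique-⊆ A⊆ (ascentList-unique (tree T))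
    ; A-ascent = ascents
    ; top      = proj₁ (sum-exists T ascents)
    ; top-sum  = proj₂ (sum-exists T ascents)
    }
    where
    ascents : All (IsTreeAscent (tree T)) A
    ascents = All-resp-⊆ A⊆ (ascentList-all (tree T))

  -- The faces with bottom T.
  facesAt : DecreasingTree s → List (PureInterval s)
  facesAt T = map (face T) (sublists (ascentList (tree T)))

  open SetoidMembership (Perm s) using () renaming (_∈_ to _∈ᶠ_)

  ∈-facesAt : (P : PureInterval s) (T : DecreasingTree s) → tree (PureInterval.bottom P) ≡ tree T → P ∈ᶠ facesAt T
  ∈-facesAt P T eq = Any.map⁺ (lose {P = λ S → P ≈ᶠ face T S} (∈-sublists (filter-⊆ (_∈? A) as))
    (interval-cong P (face T (filter (_∈? A) as , filter-⊆ (_∈? A) as)) eq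
      ((λ x∈ → ∈-filter⁺ (_∈? A) (ascent∈ x∈) x∈) , λ x∈ → proj₂ (∈-filter⁻ (_∈? A) {xs = as} x∈))))
    where
    open PureInterval P using (A; A-ascent)
    as = ascentList (tree T)
    ascent∈ : ∀ {x} → x ∈ A → x ∈ as
    ascent∈ x∈ = ∈-filter⁺ (isTreeAscent? (tree T)) (∈-cartesianProduct⁺ (∈-allFin _) (∈-allFin _))
      (subst (λ τ → IsTreeAscent τ _) eq (All.lookup A-ascent x∈))

  faceEnumeration : Enumeration (Perm s)
  faceEnumeration = record
    { elements = concatMap facesAt treeList
    ; complete = λ P → Any.concatMap⁺ facesAt (Any.map (∈-facesAt P _) (complete (PureInterval.bottom P)))
    ; distinct = AllPairs.concat⁺
        (All.map⁺ (All.universal (λ T → AllPairs.map⁺ (AllPairs.map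
          (λ {S} {S′} ne P≈Q → ne (A-cong {face T S} {face T S′} P≈Q)) (sublists-distinct (ascentList-unique (tree T))))) treeList))
        (AllPairs.map⁺ (AllPairs.map (λ {T} {U} ne → All.map⁺ (All.universal (λ S → All.map⁺ (All.universal
          (λ S′ P≈Q → ne (bottom-cong {face T S} {face U S′} P≈Q)) _)) _)) distinct))
    }
    where open Enumeration treeEnumeration

  facesAt-sum : ∀ T → sumₚ (map (λ P → t ^ₚ dim P) (facesAt T)) ≈ₚ (1ₚ +ₚ t) ^ₚ asc (tree T)
  facesAt-sum T k = trans
    (cong (λ ps → coeff (sumₚ ps) k) (sym (map-∘ {g = λ P → t ^ₚ dim P} {f = face T} (sublists (ascentList (tree T))))))
    (binomial (ascentList (tree T)) k)

proposition2p4 : ∀ {n : ℕ} (s : WeakComposition n) →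
    ∃[ f ] (IsFPolynomial s f × HasSum (Trees s) (λ T → (1ₚ +ₚ t) ^ₚ asc (tree T)) f)
proposition2p4 s = sumₚ (map weight trees)
  , record
    { finite = faceEnumeration
    ; total  = λ E k → trans
        (sum-enumerations (λ P → t ^ₚ dim P)
          (λ {P} {Q} P≈Q k → cong (λ d → coeff (t ^ₚ d) k) (dim-cong {P = P} {Q} P≈Q))
          E faceEnumeration k)
        (sumₚ-concatMap (λ P → t ^ₚ dim P) facesAt weight facesAt-sum trees k)
    }
  , record
    { finite = treeEnumeration
    ; total  = λ E → sum-enumerations weight
        (λ eq k → cong (λ τ → coeff ((1ₚ +ₚ t) ^ₚ asc τ) k) eq) E treeEnumeration
    }
  where
  weight : DecreasingTree s → Poly
  weight T = (1ₚ +ₚ t) ^ₚ asc (tree T)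
  trees : List (DecreasingTree s)
  trees = treeList
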